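{- Let $F$ be a fabric of species $33_4$ whose strands are perfectly coloured by a thick striping. If lattice units of $F$ are chosen so that their corners fall at the centres of redundant blocks of the striping, then these lattice units compose the net of a perfectly coloured isonemal woven cube.
   Context: **Prefabrics.** The plane is divided into unit square cells $[i,i+1]\times[j,j+1]$, $i,j\in\mathbb{Z}$. Each column of cells is a vertical strand (a warp) and each row a horizontal strand (a weft). A prefabric specifies, for each cell, which of the two strands crossing there is on top (seen from the obverse side). All prefabrics are periodic. A prefabric falls apart if the set of strands can be partitioned into two nonempty sets $A,B$ such that wherever a strand of $A$ crosses a strand of $B$ the strand of $A$ is on top. A fabric is a prefabric that does not fall apart. **Symmetries.** A symmetry of a prefabric is a pair $(g,\varepsilon)$ where $g$ is an isometry of the plane mapping cells to cells and $\varepsilon\in\{e,\tau\}$ ($e$ = without reversal of sides, $\tau$ = reflection in the plane of the fabric, exchanging over and under), such that for every cell $c$ the strand on top at $c$ is carried by $g$ to the strand on top at $g(c)$ if $\varepsilon=e$, and to the strand underneath at $g(c)$ if $\varepsilon=\tau$. The symmetries form the symmetry group. **Species $33_4$ and lattice units.** A group is of type $33_4$ if it is generated by the quarter-turns ($90^\circ$ rotations) without $\tau$ about two points $c$ and $d$, where $c,d$ are corners of cells and $d-c=(2a,2b)$ with $a,b$ coprime integers of opposite parity. Its translation lattice $\Lambda$ is the square lattice generated by $(2(a-b),2(a+b))$ and $(-2(a+b),2(a-b))$, and its quarter-turn centres are the points of $c+\Lambda$ and $d+\Lambda$. A fabric is of species $33_4$ if its (full) symmetry group is of type $33_4$. A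 lattice unit is a square, with sides the two generating vectors just given, whose corners are points of one of the two families $c+\Lambda$, $d+\Lambda$ of quarter-turn centres and whose centre is then in the other family; the plane is tiled by the lattice units with corners in a given family. **Thick striping.** A thick striping colours the warps dark and pale alternately in adjacent pairs (dark, dark, pale, pale, ...), and likewise the wefts. The plane is thereby divided into $2\times2$ blocks of cells, in each of which two equally coloured adjacent warps cross two equally coloured adjacent wefts. A block is redundant if its warps and wefts have the same colour, irredundant otherwise; the two kinds of block form a checkerboard. The strand colouring is perfect if every symmetry of the fabric, acting on the strands, either preserves the colour of every strand or reverses the colour of every strand. **Woven cubes.** Six lattice units from the tiling of the plane by lattice units, arranged as a net of a cube, compose the net of a woven cube: the net (with its woven, coloured strands, obverse side outward) is folded into a cube, whose faces are the six lattice units, and edges are joined so that strands continue across joined edges; strands thus become closed bands on the surface of the cube. The woven cube is isonemal if its six faces are woven in the same way, such that the rotations of the cube about its 4-fold, 3-fold and 2-fold axes are (as symmetries of the weaving) collectively transitive on the strands of the cube, and there are no centres of symmetry in the net other than the quarter-turns at the centres and corners of faces and the half-turns at the middles of their sides. A perfectly coloured isonemal woven cube is a cube woven isonemally with its strands so coloured that each rotational symmetry of the cube preserves or permutes the (two) colours showing in the cells, the colour showing in a cell being that of the strand on top (outermost) there. -}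

module Defs where

open import Data.Bool using (Bool; true; false; if_then_else_)
open import Data.Fin using (Fin; toℕ)
open import Data.Fin.Patterns using (0F; 1F; 2F; 3F)
open import Data.Integer using (ℤ; +_; 0ℤ; 1ℤ; _+_; _-_; -_; _*_; _≤_; _<_)
open import Data.Integer.Coprimality using (Coprime)
open import Data.Integer.DivMod using (_%ℕ_)
import Data.Nat as ℕ
open import Data.Nat.DivMod using (_mod_)
open import Data.Product using (Σ; ∃; ∃-syntax; _×_; _,_)
open import Data.Sum using (_⊎_)
open import Function.Bundles using (_⇔_)
open import Relation.Binary.Construct.Closure.Equivalence using (EqClosure)
open import Relation.Binary.Construct.Closure.ReflexiveTransitive using (Star)
open import Relation.Binary.PropositionalEquality using (_≡_; _≢_)
open import Relation.Nullary using (¬_)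

------------------------------------------------------------------------
-- Integer vectors

-- A pair (x , y) with a positive integer N also stands for the rational
-- point (x/N , y/N); "in N-ths" below refers to this.
Point : Set
Point = ℤ × ℤ

infixl 6 _⊞_ _⊟_
infixr 7 _⊡_

_⊞_ _⊟_ : Point → Point → Point
(x , y) ⊞ (x′ , y′) = x + x′ , y + y′
(x , y) ⊟ (x′ , y′) = x - x′ , y - y′

_⊡_ : ℤ → Point → Point
n ⊡ (x , y) = n * x , n * y

det : Point → Point → ℤ
det (x , y) (x′ , y′) = x * y′ - y * x′

------------------------------------------------------------------------
-- Prefabrics and fabrics

-- (i , j) is the cell [i,i+1]×[j,j+1]; warp i is the column
-- [i,i+1]×ℝ and weft j the row ℝ×[j,j+1].
Cell : Set
Cell = ℤ × ℤ

data Strand : Set where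
  warp weft : ℤ → Strand

Independent : Point → Point → Set
Independent p q = det p q ≢ 0ℤ

record Prefabric : Set where
  field
    warpOnTop : Cell → Bool
    periodic  : ∃[ p ] ∃[ q ] Independent p q ×
                (∀ k → warpOnTop (k ⊞ p) ≡ warpOnTop k
                     × warpOnTop (k ⊞ q) ≡ warpOnTop k)

  over under : Cell → Strand
  over  (i , j) = if warpOnTop (i , j) then warp i else weft j
  under (i , j) = if warpOnTop (i , j) then weft j else warp i

open Prefabric public

-- The partition is given by the indicator function of A.
FallsApart : Prefabric → Set
FallsApart F = Σ (Strand → Bool) λ inA →
    (∃[ s ] inA s ≡ true)
  × (∃[ s ] inA s ≡ false)
  × (∀ i j → inA (warp i) ≡ true  → inA (weft j) ≡ false → over F (i , j) ≡ warp i)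
  × (∀ i j → inA (warp i) ≡ false → inA (weft j) ≡ true  → over F (i , j) ≡ weft j)

IsFabric : Prefabric → Set
IsFabric F = ¬ FallsApart F

------------------------------------------------------------------------
-- Isometries of the plane that map cells to cells

-- Isometries of the line mapping unit intervals [i,i+1] to unit intervals:
-- pos t is x ↦ t + x and neg t is x ↦ t - x.
data Iso₁ : Set where
  pos neg : ℤ → Iso₁

-- The action on points in N-ths.
act₁ : ℤ → Iso₁ → ℤ → ℤ
act₁ N (pos t) x = N * t + x
act₁ N (neg t) x = N * t - x

-- The action on unit intervals, each named by its lower end.
interval : Iso₁ → ℤ → ℤ
interval (pos t) i = t + i
interval (neg t) i = t - 1ℤ - i

infixr 9 _∘₁_ _∘₂_

_∘₁_ : Iso₁ → Iso₁ → Iso₁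
pos s ∘₁ pos t = pos (s + t)
pos s ∘₁ neg t = neg (s + t)
neg s ∘₁ pos t = neg (s - t)
neg s ∘₁ neg t = pos (s - t)

inv₁ : Iso₁ → Iso₁
inv₁ (pos t) = pos (- t)
inv₁ (neg t) = neg t

-- straight h k is (x,y) ↦ (h x , k y) and swapped h k is
-- (x,y) ↦ (h y , k x).
data Isometry : Set where
  straight swapped : Iso₁ → Iso₁ → Isometry

idᵢ : Isometry
idᵢ = straight (pos 0ℤ) (pos 0ℤ)

_∘₂_ : Isometry → Isometry → Isometry
straight h k ∘₂ straight h′ k′ = straight (h ∘₁ h′) (k ∘₁ k′)
straight h k ∘₂ swapped  h′ k′ = swapped  (h ∘₁ h′) (k ∘₁ k′)
swapped  h k ∘₂ straight h′ k′ = swapped  (h ∘₁ k′) (k ∘₁ h′)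
swapped  h k ∘₂ swapped  h′ k′ = straight (h ∘₁ k′) (k ∘₁ h′)

inv₂ : Isometry → Isometry
inv₂ (straight h k) = straight (inv₁ h) (inv₁ k)
inv₂ (swapped  h k) = swapped  (inv₁ k) (inv₁ h)

actPoint : ℤ → Isometry → Point → Point
actPoint N (straight h k) (x , y) = act₁ N h x , act₁ N k y
actPoint N (swapped  h k) (x , y) = act₁ N h y , act₁ N k x

actCell : Isometry → Cell → Cell
actCell (straight h k) (i , j) = interval h i , interval k j
actCell (swapped  h k) (i , j) = interval h j , interval k i

actStrand : Isometry → Strand → Strand
actStrand (straight h k) (warp i) = warp (interval h i)
actStrand (straight h k) (weft j) = weft (interval k j)
actStrand (swapped  h k) (warp i) = weft (interval k i)
actStrand (swapped  h k) (weft j) = warp (interval h j)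

-- The rotation of the plane through k anticlockwise quarter-turns that
-- carries P to Q.
motion : Fin 4 → Point → Point → Isometry
motion 0F (px , py) (qx , qy) = straight (pos (qx - px)) (pos (qy - py))
motion 1F (px , py) (qx , qy) = swapped  (neg (qx + py)) (pos (qy - px))
motion 2F (px , py) (qx , qy) = straight (neg (qx + px)) (neg (qy + py))
motion 3F (px , py) (qx , qy) = swapped  (pos (qx - py)) (neg (qy + px))

-- g turns the plane through k quarter-turns (a translation if k = 0).
IsTurn : Fin 4 → Isometry → Set
IsTurn k g = ∃[ Q ] g ≡ motion k (0ℤ , 0ℤ) Q

------------------------------------------------------------------------
-- Symmetries

data Reversal : Set where
  e τ : Reversal

_∙_ : Reversal → Reversal → Reversal
e ∙ ε = ε
τ ∙ e = τ
τ ∙ τ = e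

Symmetry : Set
Symmetry = Isometry × Reversal

-- g carries the strand on top at k to the strand on top at g k (for e),
-- or to the strand underneath there (for τ).
Carries : Prefabric → Symmetry → Cell → Set
Carries F (g , e) k = actStrand g (over F k) ≡ over  F (actCell g k)
Carries F (g , τ) k = actStrand g (over F k) ≡ under F (actCell g k)

IsSymmetry : Prefabric → Symmetry → Set
IsSymmetry F σ = ∀ k → Carries F σ k

data Generated (σ₁ σ₂ : Symmetry) : Symmetry → Set where
  gen₁ : Generated σ₁ σ₂ σ₁
  gen₂ : Generated σ₁ σ₂ σ₂
  unit : Generated σ₁ σ₂ (idᵢ , e)
  comp : ∀ {g h ε η} → Generated σ₁ σ₂ (g , ε) → Generated σ₁ σ₂ (h , η) →
         Generated σ₁ σ₂ (g ∘₂ h , ε ∙ η)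
  inv  : ∀ {g ε} → Generated σ₁ σ₂ (g , ε) → Generated σ₁ σ₂ (inv₂ g , ε)

quarterTurn : Point → Symmetry
quarterTurn c = motion 1F c c , e

-- F is of species 33₄, its symmetry group being generated by the
-- quarter-turns about c and d, with d - c = (2a , 2b).
record Species33₄ (F : Prefabric) (c d : Point) (a b : ℤ) : Set where
  field
    coprime        : Coprime a b
    oppositeParity : a %ℕ 2 ≢ b %ℕ 2
    separation     : d ⊟ c ≡ (+ 2 * a , + 2 * b)
    group          : ∀ σ → IsSymmetry F σ ⇔
                     Generated (quarterTurn c) (quarterTurn d) σ

------------------------------------------------------------------------
-- Thick striping

data Colour : Set where
  dark pale : Colour

flip : Colour → Colour
flip dark = pale
flip pale = dark

Colouring : Set
Colouring = Strand → Colour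

-- Positions p, p+1 dark, p+2, p+3 pale, and so on with period 4.
stripe : ℤ → ℤ → Colour
stripe p i = if ((i - p) %ℕ 4) ℕ.<ᵇ 2 then dark else pale

thickStriping : (p q : ℤ) → Colouring
thickStriping p q (warp i) = stripe p i
thickStriping p q (weft j) = stripe q j

Perfect : Prefabric → Colouring → Set
Perfect F κ = ∀ g ε → IsSymmetry F (g , ε) →
    (∀ s → κ (actStrand g s) ≡ κ s)
  ⊎ (∀ s → κ (actStrand g s) ≡ flip (κ s))

-- Under a thick striping, neighbouring strands have the same colour exactly
-- when they form one of the pairs, so the first two conditions say that
-- (x , y) is the centre of a block.
RedundantCentre : Colouring → Point → Set
RedundantCentre κ (x , y) =
    κ (warp (x - 1ℤ)) ≡ κ (warp x)
  × κ (weft (y - 1ℤ)) ≡ κ (weft y)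
  × κ (warp x) ≡ κ (weft y)

------------------------------------------------------------------------
-- The tiling by lattice units with corners in o + Λ

-- The sides of a unit are numbered anticlockwise.
next opposite : Fin 4 → Fin 4
next 0F = 1F
next 1F = 2F
next 2F = 3F
next 3F = 0F
opposite s = next (next s)

-- The number of anticlockwise quarter-turns from t to s.
_⊝_ : Fin 4 → Fin 4 → Fin 4
s ⊝ t = (toℕ s ℕ.+ (4 ℕ.∸ toℕ t)) mod 4

Index : Set
Index = ℤ × ℤ

module Tiling (o : Point) (a b : ℤ) where

  u v : Point
  u = + 2 * (a - b) , + 2 * (a + b)
  v = - (+ 2 * (a + b)) , + 2 * (a - b)

  -- The unit (m , n) has corners o + mu + nv, o + (m+1)u + nv,
  -- o + (m+1)u + (n+1)v, o + mu + (n+1)v.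
  corner : Index → Point
  corner (m , n) = o ⊞ m ⊡ u ⊞ n ⊡ v

  start end : Index → Fin 4 → Point
  start (m , n) 0F = corner (m , n)
  start (m , n) 1F = corner (m + 1ℤ , n)
  start (m , n) 2F = corner (m + 1ℤ , n + 1ℤ)
  start (m , n) 3F = corner (m , n + 1ℤ)
  end w s = start w (next s)

  neighbour : Index → Fin 4 → Index
  neighbour (m , n) 0F = m , n - 1ℤ
  neighbour (m , n) 1F = m + 1ℤ , n
  neighbour (m , n) 2F = m , n + 1ℤ
  neighbour (m , n) 3F = m - 1ℤ , n

  -- Positive, zero or negative according as P (in N-ths) is to the left
  -- of, on, or to the right of the line along the side s of w.
  leftOf : ℤ → Point → Index → Fin 4 → ℤ
  leftOf N P w s = det (end w s ⊟ start w s) (P ⊟ N ⊡ start w s)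

  InClosedUnit InOpenUnit : ℤ → Point → Index → Set
  InClosedUnit N P w = ∀ s → 0ℤ ≤ leftOf N P w s
  InOpenUnit   N P w = ∀ s → 0ℤ < leftOf N P w s

  OnOpenSide : ℤ → Point → Index → Fin 4 → Set
  OnOpenSide N P w s = leftOf N P w s ≡ 0ℤ × (∀ t → t ≢ s → 0ℤ < leftOf N P w t)

  InOpenCell : ℤ → Point → Cell → Set
  InOpenCell N (x , y) (i , j) =
      (N * i < x × x < N * (i + 1ℤ))
    × (N * j < y × y < N * (j + 1ℤ))

  CellMeetsUnit : Cell → Index → Set
  CellMeetsUnit k w = ∃[ N ] ∃[ P ] 0ℤ < N × InOpenCell N P k × InOpenUnit N P w

  CellCutBySide : Cell → Index → Fin 4 → Set
  CellCutBySide k w s = ∃[ N ] ∃[ P ] 0ℤ < N × InOpenCell N P k × OnOpenSide N P w s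

  -- The ends of a side are corners of cells, so a strand whose interior
  -- meets the side crosses it in its whole width.
  Between : ℤ → ℤ → ℤ → Set
  Between x x′ i = (x ≤ i × i < x′) ⊎ (x′ ≤ i × i < x)

  SpannedBy : Point → Point → Strand → Set
  SpannedBy (x , y) (x′ , y′) (warp i) = Between x x′ i
  SpannedBy (x , y) (x′ , y′) (weft j) = Between y y′ j

  CrossesSide : Strand → Index → Fin 4 → Set
  CrossesSide r w s = SpannedBy (start w s) (end w s) r

  CrossesUnit : Strand → Index → Set
  CrossesUnit r w = ∃[ s ] CrossesSide r w s

  -- The points about which the net of an isonemal woven cube has turns
  -- through k quarter-turns, in halves: the centre and corners of a face,
  -- and for half-turns also the middles of its sides.
  CentreOfTurn : Fin 4 → Point → Index → Set
  CentreOfTurn k P w =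
      P ≡ start w 0F ⊞ start w 2F
    ⊎ (∃[ s ] P ≡ + 2 ⊡ start w s)
    ⊎ (k ≡ 2F × ∃[ s ] P ≡ start w s ⊞ end w s)

------------------------------------------------------------------------
-- The cube

-- Faces of the cube, named by their outward normals (x, y, z right-handed).
data Face : Set where
  +x -x +y -y +z -z : Face

antipode : Face → Face
antipode +x = -x
antipode -x = +x
antipode +y = -y
antipode -y = +y
antipode +z = -z
antipode -z = +z

-- Two faces with a common edge.  The edge of f shared with t is called
-- the edge of f towards t.
_⟂_ : Face → Face → Set
f ⟂ t = t ≢ f × t ≢ antipode f

-- The effect on faces of the quarter-turn of the cube about the outward
-- normal of f, anticlockwise as seen from outside.
turn : Face → Face → Face
turn +x +y = +z
turn +x +z = -y
turn +x -y = -z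
turn +x -z = +y
turn +x +x = +x
turn +x -x = -x
turn +y +z = +x
turn +y +x = -z
turn +y -z = -x
turn +y -x = +z
turn +y +y = +y
turn +y -y = -y
turn +z +x = +y
turn +z +y = -x
turn +z -x = -y
turn +z -y = +x
turn +z +z = +z
turn +z -z = -z
turn -x +y = -z
turn -x -z = -y
turn -x -y = +z
turn -x +z = +y
turn -x +x = +x
turn -x -x = -x
turn -y +z = -x
turn -y -x = -z
turn -y -z = +x
turn -y +x = +z
turn -y +y = +y
turn -y -y = -y
turn -z +x = -y
turn -z -y = -x
turn -z -x = +y
turn -z +y = +x
turn -z +z = +z
turn -z -z = -z

-- Exactly the 24 rotations of the cube satisfy these conditions.
record CubeRotation : Set where
  field
    to          : Face → Face
    to-antipode : ∀ f → to (antipode f) ≡ antipode (to f)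
    to-turn     : ∀ f t → to (turn f t) ≡ turn (to f) (to t)

open CubeRotation public

-- Six lattice units that fold up into the cube, the obverse side (from which
-- the plane is seen) becoming the outside: place f is the unit that becomes
-- the face f, and, for f ⟂ t, side f t is the side of that unit that becomes
-- the edge of f towards t.  (The value of side f t is irrelevant if
-- not f ⟂ t.)  Hinges are the sides along which the net is not cut.
record Net (o : Point) (a b : ℤ) : Set where
  open Tiling o a b

  field
    place    : Face → Index
    side     : Face → Face → Fin 4
    distinct : ∀ f f′ → place f ≡ place f′ → f ≡ f′
    ccw      : ∀ f t → f ⟂ t → side f (turn f t) ≡ next (side f t)

  Hinge : Face → Face → Set
  Hinge f t = f ⟂ t
            × place t ≡ neighbour (place f) (side f t)
            × side t f ≡ opposite (side f t)

  field
    connected : ∀ f f′ → Star Hinge f f′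

------------------------------------------------------------------------
-- The woven cube

module WovenCube
  (F : Prefabric) (κ : Colouring) (o : Point) (a b : ℤ) (N : Net o a b) where

  open Tiling o a b
  open Net N

  -- The rotation of the plane that carries the side s of w to the side s′ of
  -- w′, and w to w′.
  carry : Index → Fin 4 → Index → Fin 4 → Isometry
  carry w s w′ s′ = motion (s′ ⊝ s) (start w s) (start w′ s′)

  -- Edges of the faces f and t are joined by carrying the side of place f
  -- to the side of place t in such a way that place f comes to lie next to
  -- place t (hence with the ends of the sides interchanged).  This is the
  -- identity if the edge is a hinge of the net.
  join : Face → Face → Isometry
  join f t = motion (opposite (side t f) ⊝ side f t)
                    (start (place f) (side f t))
                    (end   (place t) (side t f))

  -- A rotation R of the cube takes the face f to the face R f, and the edge
  -- of f towards t to the edge of R f towards R t; so it acts on the face f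
  -- by this rotation of the plane, whichever t ⟂ f is used.
  move : CubeRotation → Face → Face → Isometry
  move R f t = carry (place f) (side f t) (place (to R f)) (side (to R f) (to R t))

  CellOnFace : Cell → Face → Set
  CellOnFace k f = CellMeetsUnit k (place f)

  -- A strand of the cube consists of pieces (f , s), the parts within faces
  -- f of strands s of the plane, continuing each other across joined edges.
  Piece : Set
  Piece = Face × Strand

  data Continues : Piece → Piece → Set where
    across : ∀ {f t s} → f ⟂ t → CrossesSide s (place f) (side f t) →
             Continues (f , s) (t , actStrand (join f t) s)

  SameStrand : Piece → Piece → Set
  SameStrand = EqClosure Continues

  shown : Cell → Colour
  shown k = κ (over F k)

  -- Strands continue across joined edges, with their colours, and the parts
  -- of a cell cut by an edge agree on which strand is on top.
  record IsWovenCube : Set where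
    field
      strands : ∀ f t → f ⟂ t → ∀ s → CrossesSide s (place f) (side f t) →
                CrossesSide (actStrand (join f t) s) (place t) (side t f)
      weaving : ∀ f t → f ⟂ t → ∀ k → CellCutBySide k (place f) (side f t) →
                Carries F (join f t , e) k
      colours : ∀ f t → f ⟂ t → ∀ s → CrossesSide s (place f) (side f t) →
                κ (actStrand (join f t) s) ≡ κ s

  record IsIsonemal : Set where
    field
      facesAlike : ∀ f f′ → ∃[ s ] ∃[ s′ ] ∀ k → CellOnFace k f →
                   Carries F (carry (place f) s (place f′) s′ , e) k
      rotations  : ∀ R f t → f ⟂ t → ∀ k → CellOnFace k f →
                   Carries F (move R f t , e) k
      transitive : ∀ f s f′ s′ →
                   CrossesUnit s (place f) → CrossesUnit s′ (place f′) →
                   ∃[ R ] ∃[ t ] f ⟂ t ×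
                   SameStrand (to R f , actStrand (move R f t) s) (f′ , s′)
      -- Centres of rotations in Isometry have coordinates in ½ℤ, so it is
      -- enough to consider points in halves.
      centres    : ∀ k g P f → k ≢ 0F → IsTurn k g → actPoint (+ 2) g P ≡ P →
                   CentreOfTurn k P (place f) → IsSymmetry F (g , e)
      noOthers   : ∀ k g ε P f → k ≢ 0F → IsTurn k g → actPoint (+ 2) g P ≡ P →
                   InClosedUnit (+ 2) P (place f) → IsSymmetry F (g , ε) →
                   CentreOfTurn k P (place f)

  PerfectlyColoured : Set
  PerfectlyColoured = ∀ R →
      (∀ f t → f ⟂ t → ∀ k → CellOnFace k f →
         shown (actCell (move R f t) k) ≡ shown k)
    ⊎ (∀ f t → f ⟂ t → ∀ k → CellOnFace k f →
         shown (actCell (move R f t) k) ≡ flip (shown k))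

  record IsPerfectlyColouredIsonemalWovenCube : Set where
    field
      wovenCube         : IsWovenCube
      isonemal          : IsIsonemal
      perfectlyColoured : PerfectlyColoured

module Submission where

-- With cells as Gaussian integers, u generates the ideal of translations and
-- the corners of units are the points o + zu.  The symmetries of F are the
-- rotations that permute these corners, by z ↦ y + iᵏz, so every carry, join
-- and move is a symmetry.  Since a - b and a + b are odd, neighbouring corners
-- lie in redundant blocks of opposite colours; hence a symmetry preserves
-- colours or reverses them according to what it does to the chessboard
-- colouring of the corners.  That colouring descends to the 2-colouring of the
-- vertices of the cube, because the net is connected: so joins preserve
-- colours, and a rotation of the cube preserves or reverses them throughout.
-- For transitivity, the group is transitive on the strands of the plane (by
-- Bézout), and rolling the cube along a strand of the plane compares any two
-- pieces of strands of the cube that come from it.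

open import Defs
open import Algebra.Bundles using (CommutativeRing)
open import Data.Bool using (if_then_else_)
open import Data.Empty using (⊥-elim)
open import Data.Fin using (Fin)
open import Data.Fin.Patterns using (0F; 1F; 2F; 3F; 4F; 5F)
import Data.Fin.Properties as Fin
open import Data.Integer using
  ( ℤ; +_; -[1+_]; +0; 0ℤ; 1ℤ; -1ℤ; _+_; _-_; -_; _*_; _≤_; _<_; _≤?_; ∣_∣
  ; NonNegative; nonNegative; positive; +≤+; +<+; -<- )
open import Data.Integer.Coprimality using (Coprime)
open import Data.Integer.DivMod using (_%ℕ_; _/ℕ_; n%ℕd<d; a≡a%ℕn+[a/ℕn]*n)
import Data.Integer.Properties as ℤ
import Data.Integer.Tactic.RingSolver as ℤSolver
open import Data.Maybe using (just; nothing)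
open import Data.Nat as ℕ using (ℕ; suc; s≤s; z≤n)
open import Data.Nat.Coprimality using (coprime-Bézout)
open import Data.Nat.GCD using (module Bézout)
open import Data.Product as Product using (Σ; ∃; ∃-syntax; _×_; _,_; proj₁; proj₂)
import Data.Product.Properties as Product
open import Data.Sum as Sum using (_⊎_; inj₁; inj₂)
open import Function using (_∘_; case_of_; Equivalence)
open import Level using (0ℓ)
open import Relation.Binary using (DecidableEquality; tri<; tri≈; tri>)
open import Relation.Binary.Construct.Closure.ReflexiveTransitive using (Star; ε; _◅_)
open import Relation.Binary.Construct.Closure.Symmetric using (bwd)
open import Relation.Binary.PropositionalEquality
open import Relation.Nullary using (Dec; yes; no; contradiction; ¬?; _×-dec_; _→-dec_)
open import Relation.Nullary.Decidable using (does; from-yes; map′; decidable-stable)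
open import Tactic.RingSolver using (solve-∀)
open import Tactic.RingSolver.Core.AlmostCommutativeRing
  using (AlmostCommutativeRing; fromCommutativeRing)

-- The ring of Gaussian integers

-- Units, sides and neighbours are named by indices and by the offsets `δ`, so facts about them
-- become identities in ℤ[i], valid for all a and b, together with finite checks over `Fin 4` and
-- over the faces of the cube. Two difficulties shape the rest. The two sides joined along a cut
-- edge of the net may lie far apart in the plane, so nothing local compares their colours; they are
-- compared through the vertices of the cube, the comparison being fixed at one flag and spread
-- along hinges. And the way in which a strand of the cube closes up depends on a and b. Its course
-- is never computed: a predicate on units that is stable under crossing the sides met by a strand
-- of the plane is shown to pass from any unit on that strand to any other, and the predicate chosen
-- says that the cube, rolled along the strand, comes to lie there. The face then lying on the unit,
-- with one of its edges, is a flag, and a flag determines a rotation of the cube.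

infixl 7 _·_
infix 8 ~_

_·_ : Point → Point → Point
(x , y) · (x′ , y′) = x * x′ - y * y′ , x * y′ + y * x′

~_ : Point → Point
~ (x , y) = - x , - y

𝟘 𝟙 : Point
𝟘 = 0ℤ , 0ℤ
𝟙 = 1ℤ , 0ℤ

gaussianIntegers : CommutativeRing 0ℓ 0ℓ
gaussianIntegers = record
  { Carrier = Point ; _≈_ = _≡_ ; _+_ = _⊞_ ; _*_ = _·_ ; -_ = ~_ ; 0# = 𝟘 ; 1# = 𝟙
  ; isCommutativeRing = record
    { isRing = record
      { +-isAbelianGroup = record
        { isGroup = record
          { isMonoid = record
            { isSemigroup = record
              { isMagma = record { isEquivalence = isEquivalence ; ∙-cong = cong₂ _⊞_ }
              ; assoc = λ x y z → cong₂ _,_ (ℤ.+-assoc (proj₁ x) (proj₁ y) (proj₁ z)) (ℤ.+-assoc (proj₂ x) (proj₂ y) (proj₂ z)) }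
            ; identity = (λ x → cong₂ _,_ (ℤ.+-identityˡ _) (ℤ.+-identityˡ _))
                       , (λ x → cong₂ _,_ (ℤ.+-identityʳ _) (ℤ.+-identityʳ _)) }
          ; inverse = (λ x → cong₂ _,_ (ℤ.+-inverseˡ (proj₁ x)) (ℤ.+-inverseˡ (proj₂ x)))
                    , (λ x → cong₂ _,_ (ℤ.+-inverseʳ (proj₁ x)) (ℤ.+-inverseʳ (proj₂ x)))
          ; ⁻¹-cong = cong ~_ }
        ; comm = λ x y → cong₂ _,_ (ℤ.+-comm (proj₁ x) (proj₁ y)) (ℤ.+-comm (proj₂ x) (proj₂ y)) }
      ; *-cong = cong₂ _·_
      ; *-assoc = λ (x , y) (z , w) (s , t) → cong₂ _,_ (assoc₁ x y z w s t) (assoc₂ x y z w s t)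
      ; *-identity = (λ (x , y) → cong₂ _,_ (idˡ x y) (idˡ₂ x y)) , (λ (x , y) → cong₂ _,_ (idʳ x y) (idʳ₂ x y))
      ; distrib = (λ (x , y) (z , w) (s , t) → cong₂ _,_ (dˡ₁ x y z w s t) (dˡ₂ x y z w s t))
                , (λ (x , y) (z , w) (s , t) → cong₂ _,_ (dʳ₁ x y z w s t) (dʳ₂ x y z w s t)) }
    ; *-comm = λ (x , y) (z , w) → cong₂ _,_ (comm₁ x y z w) (comm₂ x y z w) } }
  where
  assoc₁ : ∀ x y z w s t → (x * z - y * w) * s - (x * w + y * z) * t ≡ x * (z * s - w * t) - y * (z * t + w * s)
  assoc₁ = solve-∀ ℤSolver.ring
  assoc₂ : ∀ x y z w s t → (x * z - y * w) * t + (x * w + y * z) * s ≡ x * (z * t + w * s) + y * (z * s - w * t)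
  assoc₂ = solve-∀ ℤSolver.ring
  idˡ : ∀ x y → 1ℤ * x - 0ℤ * y ≡ x
  idˡ = solve-∀ ℤSolver.ring
  idˡ₂ : ∀ x y → 1ℤ * y + 0ℤ * x ≡ y
  idˡ₂ = solve-∀ ℤSolver.ring
  idʳ : ∀ x y → x * 1ℤ - y * 0ℤ ≡ x
  idʳ = solve-∀ ℤSolver.ring
  idʳ₂ : ∀ x y → x * 0ℤ + y * 1ℤ ≡ y
  idʳ₂ = solve-∀ ℤSolver.ring
  dˡ₁ : ∀ x y z w s t → x * (z + s) - y * (w + t) ≡ x * z - y * w + (x * s - y * t)
  dˡ₁ = solve-∀ ℤSolver.ring
  dˡ₂ : ∀ x y z w s t → x * (w + t) + y * (z + s) ≡ x * w + y * z + (x * t + y * s)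
  dˡ₂ = solve-∀ ℤSolver.ring
  dʳ₁ : ∀ x y z w s t → (z + s) * x - (w + t) * y ≡ z * x - w * y + (s * x - t * y)
  dʳ₁ = solve-∀ ℤSolver.ring
  dʳ₂ : ∀ x y z w s t → (z + s) * y + (w + t) * x ≡ z * y + w * x + (s * y + t * x)
  dʳ₂ = solve-∀ ℤSolver.ring
  comm₁ : ∀ x y z w → x * z - y * w ≡ z * x - w * y
  comm₁ = solve-∀ ℤSolver.ring
  comm₂ : ∀ x y z w → x * w + y * z ≡ z * y + w * x
  comm₂ = solve-∀ ℤSolver.ring

gaussianRing : AlmostCommutativeRing 0ℓ 0ℓ
gaussianRing = fromCommutativeRing gaussianIntegers λ where
  (+0 , +0) → just refl
  _         → nothing

-- Parity and stripes

-1<i<1⇒i≡0 : ∀ {i} → -1ℤ < i → i < 1ℤ → i ≡ 0ℤ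
-1<i<1⇒i≡0 {+0}       _ _ = refl
-1<i<1⇒i≡0 {+ suc _}  _ (+<+ (s≤s ()))
-1<i<1⇒i≡0 { -[1+ _ ]} (-<- ()) _

-- Two numbers in [0, n) are less than n apart, so - n < t * n < n. This serves both for remainders
-- and, with n the height of a unit, for units along a strand.
quotient-unique : ∀ {n x y} t → 0ℤ ≤ x → x < n → 0ℤ ≤ y → y < n → x ≡ y + t * n → t ≡ 0ℤ
quotient-unique {n} {x} {y} t 0≤x x<n 0≤y y<n x≡ =
  -1<i<1⇒i≡0
    (ℤ.*-cancelʳ-<-nonNeg n (subst₂ _<_ (sym (ℤ.-1*i≡-i n)) x-y≡ (begin-strict
      - n      <⟨ ℤ.neg-mono-< y<n ⟩
      - y      ≡⟨ ℤ.+-identityˡ (- y) ⟨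
      0ℤ - y   ≤⟨ ℤ.+-monoˡ-≤ (- y) 0≤x ⟩
      x - y    ∎)))
    (ℤ.*-cancelʳ-<-nonNeg n (subst₂ _<_ x-y≡ (sym (ℤ.*-identityˡ n)) (begin-strict
      x - y    ≤⟨ ℤ.+-monoʳ-≤ x (ℤ.neg-mono-≤ 0≤y) ⟩
      x + 0ℤ   ≡⟨ ℤ.+-identityʳ x ⟩
      x        <⟨ x<n ⟩
      n        ∎)))
  where
  open ℤ.≤-Reasoning
  instance
    n-nonNegative : NonNegative n
    n-nonNegative = nonNegative (ℤ.<⇒≤ (ℤ.≤-<-trans 0≤x x<n))
  lemma : ∀ y s → y + s - y ≡ s
  lemma = solve-∀ ℤSolver.ring
  x-y≡ : x - y ≡ t * n
  x-y≡ = trans (cong (_- y) x≡) (lemma y (t * n))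

%ℕ-unique : ∀ {i} n .{{_ : ℕ.NonZero n}} r q → r ℕ.< n → i ≡ + r + q * + n → i %ℕ n ≡ r
%ℕ-unique {i} n r q r<n i≡ = ℤ.+-injective
  (trans difference (trans (cong (λ s → + r + s * + n) t≡0) (lemma₀ (+ r) (+ n))))
  where
  t = q - i /ℕ n
  lemma : ∀ i r q q′ n → r + q * n ≡ i + q′ * n → i ≡ r + (q - q′) * n
  lemma i r q q′ n eq = trans (lemma₁ i q′ n) (trans (cong (_- q′ * n) (sym eq)) (lemma₂ r q q′ n))
    where
    lemma₁ : ∀ i q′ n → i ≡ i + q′ * n - q′ * n
    lemma₁ = solve-∀ ℤSolver.ring
    lemma₂ : ∀ r q q′ n → r + q * n - q′ * n ≡ r + (q - q′) * n
    lemma₂ = solve-∀ ℤSolver.ring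
  lemma₀ : ∀ r n → r + 0ℤ * n ≡ r
  lemma₀ = solve-∀ ℤSolver.ring
  difference : + (i %ℕ n) ≡ + r + t * + n
  difference = lemma (+ (i %ℕ n)) (+ r) q (i /ℕ n) (+ n) (trans (sym i≡) (a≡a%ℕn+[a/ℕn]*n i n))
  t≡0 : t ≡ 0ℤ
  t≡0 = quotient-unique t (+≤+ z≤n) (+<+ (n%ℕd<d i n)) (+≤+ z≤n) (+<+ r<n) difference

halve : ∀ i → ∃[ j ] (i ≡ + 2 * j ⊎ i ≡ 1ℤ + + 2 * j)
halve i = i /ℕ 2 , go (i %ℕ 2) (n%ℕd<d i 2) (a≡a%ℕn+[a/ℕn]*n i 2)
  where
  even : ∀ j → 0ℤ + j * + 2 ≡ + 2 * j
  even = solve-∀ ℤSolver.ring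
  odd : ∀ j → 1ℤ + j * + 2 ≡ 1ℤ + + 2 * j
  odd = solve-∀ ℤSolver.ring
  go : ∀ {q} r → r ℕ.< 2 → i ≡ + r + q * + 2 → i ≡ + 2 * q ⊎ i ≡ 1ℤ + + 2 * q
  go {q} 0 _ i≡ = inj₁ (trans i≡ (even q))
  go {q} 1 _ i≡ = inj₂ (trans i≡ (odd q))
  go (suc (suc _)) (s≤s (s≤s ()))

Odd : ℤ → Set
Odd i = ∃[ j ] i ≡ 1ℤ + + 2 * j

even-residue : ∀ i → (+ 2 * i) %ℕ 2 ≡ 0
even-residue i = %ℕ-unique 2 0 i (s≤s z≤n) (lemma i)
  where
  lemma : ∀ i → + 2 * i ≡ 0ℤ + i * + 2
  lemma = solve-∀ ℤSolver.ring

odd-residue : ∀ i → (1ℤ + + 2 * i) %ℕ 2 ≡ 1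
odd-residue i = %ℕ-unique 2 1 i (s≤s (s≤s z≤n)) (lemma i)
  where
  lemma : ∀ i → 1ℤ + + 2 * i ≡ 1ℤ + i * + 2
  lemma = solve-∀ ℤSolver.ring

even≢odd : ∀ {i j} → + 2 * i ≢ 1ℤ + + 2 * j
even≢odd {i} {j} eq =
  case trans (sym (even-residue i)) (trans (cong (_%ℕ 2) eq) (odd-residue j)) of λ ()

oppositeParity⇒odd : ∀ {a b} → a %ℕ 2 ≢ b %ℕ 2 → Odd (a - b)
oppositeParity⇒odd {a} {b} a≢b with halve a | halve b
... | i , inj₁ refl | j , inj₂ refl = i - j - 1ℤ , lemma i j
  where
  lemma : ∀ i j → + 2 * i - (1ℤ + + 2 * j) ≡ 1ℤ + + 2 * (i - j - 1ℤ)
  lemma = solve-∀ ℤSolver.ring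
... | i , inj₂ refl | j , inj₁ refl = i - j , lemma i j
  where
  lemma : ∀ i j → 1ℤ + + 2 * i - + 2 * j ≡ 1ℤ + + 2 * (i - j)
  lemma = solve-∀ ℤSolver.ring
... | i , inj₁ refl | j , inj₁ refl = contradiction (trans (even-residue i) (sym (even-residue j))) a≢b
... | i , inj₂ refl | j , inj₂ refl = contradiction (trans (odd-residue i) (sym (odd-residue j))) a≢b

odd⇒≢0 : ∀ {i} → Odd i → i ≢ 0ℤ
odd⇒≢0 (j , i≡) i≡0 = even≢odd {0ℤ} {j} (trans (sym i≡0) i≡)

odd-sum : ∀ {a b} → Odd (a - b) → Odd (a + b)
odd-sum {a} {b} (k , eq) = k + b , trans (lemma a b) (trans (cong (λ x → x + + 2 * b) eq) (lemma₂ k b))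
  where
  lemma : ∀ a b → a + b ≡ a - b + + 2 * b
  lemma = solve-∀ ℤSolver.ring
  lemma₂ : ∀ k b → 1ℤ + + 2 * k + + 2 * b ≡ 1ℤ + + 2 * (k + b)
  lemma₂ = solve-∀ ℤSolver.ring

flip-involutive : ∀ x → flip (flip x) ≡ x
flip-involutive dark = refl
flip-involutive pale = refl

stripe-residue : ∀ p i r q → r ℕ.< 4 → i - p ≡ + r + q * + 4 → stripe p i ≡ stripe 0ℤ (+ r)
stripe-residue p i r q r<4 eq = cong (λ s → if s ℕ.<ᵇ 2 then dark else pale)
  (trans (%ℕ-unique 4 r q r<4 eq) (sym (%ℕ-unique 4 r 0ℤ r<4 (lemma (+ r)))))
  where
  lemma : ∀ r → r - 0ℤ ≡ r + 0ℤ * + 4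
  lemma = solve-∀ ℤSolver.ring

stripe-+2 : ∀ p i → stripe p (i + + 2) ≡ flip (stripe p i)
stripe-+2 p i = go ((i - p) %ℕ 4) (n%ℕd<d (i - p) 4) (a≡a%ℕn+[a/ℕn]*n (i - p) 4)
  where
  q = (i - p) /ℕ 4
  shift : ∀ r → i - p ≡ + r + q * + 4 → i + + 2 - p ≡ + 2 + + r + q * + 4
  shift r eq = trans (lemma i p) (trans (cong (λ x → + 2 + x) eq) (sym (ℤ.+-assoc (+ 2) (+ r) (q * + 4))))
    where
    lemma : ∀ i p → i + + 2 - p ≡ + 2 + (i - p)
    lemma = solve-∀ ℤSolver.ring
  carry : ∀ r q → + 4 + r + q * + 4 ≡ r + (q + 1ℤ) * + 4
  carry = solve-∀ ℤSolver.ring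
  go : ∀ r → r ℕ.< 4 → i - p ≡ + r + q * + 4 → stripe p (i + + 2) ≡ flip (stripe p i)
  go 0 r<4 eq = trans (stripe-residue p (i + + 2) 2 q (s≤s (s≤s (s≤s z≤n))) (shift 0 eq))
                      (cong flip (sym (stripe-residue p i 0 q r<4 eq)))
  go 1 r<4 eq = trans (stripe-residue p (i + + 2) 3 q (s≤s (s≤s (s≤s (s≤s z≤n)))) (shift 1 eq))
                      (cong flip (sym (stripe-residue p i 1 q r<4 eq)))
  -- Two places on, the residues 2 and 3 wrap round to 0 and 1, and the quotient grows by one.
  go 2 r<4 eq = trans (stripe-residue p (i + + 2) 0 (q + 1ℤ) (s≤s z≤n) (trans (shift 2 eq) (carry +0 q)))
                      (cong flip (sym (stripe-residue p i 2 q r<4 eq)))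
  go 3 r<4 eq = trans (stripe-residue p (i + + 2) 1 (q + 1ℤ) (s≤s (s≤s z≤n)) (trans (shift 3 eq) (carry (+ 1) q)))
                      (cong flip (sym (stripe-residue p i 3 q r<4 eq)))
  go (suc (suc (suc (suc _)))) (s≤s (s≤s (s≤s (s≤s ()))))

stripe-+4 : ∀ p i k → stripe p (i + + 4 * k) ≡ stripe p i
stripe-+4 p i k = trans
  (stripe-residue p (i + + 4 * k) r (q + k) r<4 (trans (lemma i k p) (trans (cong (λ x → x + + 4 * k) eq) (lemma₂ (+ r) q k))))
  (sym (stripe-residue p i r q r<4 eq))
  where
  r = (i - p) %ℕ 4
  q = (i - p) /ℕ 4
  r<4 = n%ℕd<d (i - p) 4
  eq = a≡a%ℕn+[a/ℕn]*n (i - p) 4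
  lemma : ∀ i k p → i + + 4 * k - p ≡ i - p + + 4 * k
  lemma = solve-∀ ℤSolver.ring
  lemma₂ : ∀ r q k → r + q * + 4 + + 4 * k ≡ r + (q + k) * + 4
  lemma₂ = solve-∀ ℤSolver.ring

-- An odd multiple of 2 is 2 modulo 4, half a period. The coordinates of neighbouring corners differ
-- by 2(a - b) or 2(a + b) up to sign, where both factors are odd.
stripe-shift : ∀ p i {j} → Odd j → stripe p (i + + 2 * j) ≡ flip (stripe p i)
stripe-shift p i {j} (k , j≡) = trans (cong (stripe p) (trans (cong (λ j → i + + 2 * j) j≡) (lemma i k)))
  (trans (stripe-+4 p (i + + 2) k) (stripe-+2 p i))
  where
  lemma : ∀ i k → i + + 2 * (1ℤ + + 2 * k) ≡ i + + 2 + + 4 * k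
  lemma = solve-∀ ℤSolver.ring

open ≡-Reasoning

-- Rotations of the plane that map cells to cells

i^_ : Fin 4 → Point
i^ 0F = 𝟙
i^ 1F = 0ℤ , 1ℤ
i^ 2F = -1ℤ , 0ℤ
i^ 3F = 0ℤ , -1ℤ

-- A computing form of multiplication by `i^ k`: with `rot` the composition law of `mot` holds by
-- `refl`, whereas the ring solver needs the product.
rot : Fin 4 → Point → Point
rot 0F z       = z
rot 1F (x , y) = - y , x
rot 2F (x , y) = - x , - y
rot 3F (x , y) = y , - x

rot≡i^ : ∀ k z → rot k z ≡ i^ k · z
rot≡i^ k z@(x , y) = go k
  where
  1+0 : ∀ x y → x ≡ 1ℤ * x - 0ℤ * y
  1+0 = solve-∀ ℤSolver.ring
  1+0′ : ∀ x y → y ≡ 1ℤ * y + 0ℤ * x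
  1+0′ = solve-∀ ℤSolver.ring
  0-1 : ∀ x y → - y ≡ 0ℤ * x - 1ℤ * y
  0-1 = solve-∀ ℤSolver.ring
  0+1 : ∀ x y → x ≡ 0ℤ * y + 1ℤ * x
  0+1 = solve-∀ ℤSolver.ring
  -1-0 : ∀ x y → - x ≡ -1ℤ * x - 0ℤ * y
  -1-0 = solve-∀ ℤSolver.ring
  -1+0 : ∀ x y → - y ≡ -1ℤ * y + 0ℤ * x
  -1+0 = solve-∀ ℤSolver.ring
  0--1 : ∀ x y → y ≡ 0ℤ * x - -1ℤ * y
  0--1 = solve-∀ ℤSolver.ring
  0+-1 : ∀ x y → - x ≡ 0ℤ * y + -1ℤ * x
  0+-1 = solve-∀ ℤSolver.ring
  go : ∀ k → rot k z ≡ i^ k · z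
  go 0F = cong₂ _,_ (1+0 x y) (1+0′ x y)
  go 1F = cong₂ _,_ (0-1 x y) (0+1 x y)
  go 2F = cong₂ _,_ (-1-0 x y) (-1+0 x y)
  go 3F = cong₂ _,_ (0--1 x y) (0+-1 x y)

infixl 6 _⊕_

-- Unlike `_⊝_`, this reduces to iterates of `next` once its first argument is known, as is wanted
-- when going round the sides of a unit.
_⊕_ : Fin 4 → Fin 4 → Fin 4
0F ⊕ l = l
1F ⊕ l = next l
2F ⊕ l = next (next l)
3F ⊕ l = next (next (next l))

⊖_ : Fin 4 → Fin 4
⊖ 0F = 0F
⊖ 1F = 3F
⊖ 2F = 2F
⊖ 3F = 1F

infix 4 _≟ᴾ_

_≟ᴾ_ : DecidableEquality Point
_≟ᴾ_ = Product.≡-dec ℤ._≟_ ℤ._≟_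

i^-⊕ : ∀ k l → i^ (k ⊕ l) ≡ i^ k · i^ l
i^-⊕ = from-yes (Fin.all? λ k → Fin.all? λ l → i^ (k ⊕ l) ≟ᴾ i^ k · i^ l)

i^-⊖ : ∀ k → i^ (⊖ k) · i^ k ≡ 𝟙
i^-⊖ = from-yes (Fin.all? λ k → i^ (⊖ k) · i^ k ≟ᴾ 𝟙)

i^-⊝ : ∀ s t → i^ (s ⊝ t) · i^ t ≡ i^ s
i^-⊝ = from-yes (Fin.all? λ s → Fin.all? λ t → i^ (s ⊝ t) · i^ t ≟ᴾ i^ s)

i^-opposite : ∀ s → i^ (opposite s) ≡ ~ i^ s
i^-opposite = from-yes (Fin.all? λ s → i^ (opposite s) ≟ᴾ ~ i^ s)

⊖-⊕ : ∀ k → ⊖ k ⊕ k ≡ 0F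
⊖-⊕ = from-yes (Fin.all? λ k → ⊖ k ⊕ k Fin.≟ 0F)

-- mot k T is z ↦ iᵏz + T.
mot : Fin 4 → Point → Isometry
mot 0F (x , y) = straight (pos x) (pos y)
mot 1F (x , y) = swapped  (neg x) (pos y)
mot 2F (x , y) = straight (neg x) (neg y)
mot 3F (x , y) = swapped  (pos x) (neg y)

motion≡mot : ∀ k P Q → motion k P Q ≡ mot k (Q ⊟ i^ k · P)
motion≡mot k P Q = trans (go k P Q) (cong (λ R → mot k (Q ⊟ R)) (rot≡i^ k P))
  where
  +≡-- : ∀ x y → x + y ≡ x - - y
  +≡-- = solve-∀ ℤSolver.ring
  go : ∀ k P Q → motion k P Q ≡ mot k (Q ⊟ rot k P)
  go 0F P Q = refl
  go 1F (px , py) (qx , qy) = cong₂ swapped (cong neg (+≡-- qx py)) refl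
  go 2F (px , py) (qx , qy) = cong₂ straight (cong neg (+≡-- qx px)) (cong neg (+≡-- qy py))
  go 3F (px , py) (qx , qy) = cong₂ swapped refl (cong neg (+≡-- qy px))

mot-∘ : ∀ k S l T → mot k S ∘₂ mot l T ≡ mot (k ⊕ l) (S ⊞ i^ k · T)
mot-∘ k S l T = trans (go k l) (cong (λ R → mot (k ⊕ l) (S ⊞ R)) (rot≡i^ k T))
  where
  go : ∀ k l → mot k S ∘₂ mot l T ≡ mot (k ⊕ l) (S ⊞ rot k T)
  go 0F 0F = refl
  go 0F 1F = refl
  go 0F 2F = refl
  go 0F 3F = refl
  go 1F 0F = refl
  go 1F 1F = refl
  go 1F 2F = refl
  go 1F 3F = refl
  go 2F 0F = refl
  go 2F 1F = refl
  go 2F 2F = refl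
  go 2F 3F = refl
  go 3F 0F = refl
  go 3F 1F = refl
  go 3F 2F = refl
  go 3F 3F = refl

mot-inverse : ∀ k T → inv₂ (mot k T) ≡ mot (⊖ k) (~ (i^ (⊖ k) · T))
mot-inverse k T = trans (go k T) (cong (λ R → mot (⊖ k) (~ R)) (rot≡i^ (⊖ k) T))
  where
  -- inv₁ leaves a reflection alone, whence the double negations.
  go : ∀ k T → inv₂ (mot k T) ≡ mot (⊖ k) (~ rot (⊖ k) T)
  go 0F T = refl
  go 1F (x , y) = cong₂ swapped refl (cong neg (sym (ℤ.neg-involutive x)))
  go 2F (x , y) = cong₂ straight (cong neg (sym (ℤ.neg-involutive x))) (cong neg (sym (ℤ.neg-involutive y)))
  go 3F (x , y) = cong₂ swapped (cong neg (sym (ℤ.neg-involutive y))) refl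

-- With `offset`, a left inverse of `mot`; the values on reflections are arbitrary.
turnOf : Isometry → Fin 4
turnOf (straight (pos _) _) = 0F
turnOf (straight (neg _) _) = 2F
turnOf (swapped  (pos _) _) = 3F
turnOf (swapped  (neg _) _) = 1F

shift : Iso₁ → ℤ
shift (pos t) = t
shift (neg t) = t

offset : Isometry → Point
offset (straight h k) = shift h , shift k
offset (swapped  h k) = shift h , shift k

turnOf-mot : ∀ k T → turnOf (mot k T) ≡ k
turnOf-mot 0F T = refl
turnOf-mot 1F T = refl
turnOf-mot 2F T = refl
turnOf-mot 3F T = refl

offset-mot : ∀ k T → offset (mot k T) ≡ T
offset-mot 0F T = refl
offset-mot 1F T = refl
offset-mot 2F T = refl
offset-mot 3F T = refl

mot-injective : ∀ {k l S T} → mot k S ≡ mot l T → k ≡ l × S ≡ T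
mot-injective {k} {l} {S} {T} eq =
    trans (sym (turnOf-mot k S)) (trans (cong turnOf eq) (turnOf-mot l T))
  , trans (sym (offset-mot k S)) (trans (cong offset eq) (offset-mot l T))

actPoint-mot : ∀ n k T P → actPoint n (mot k T) P ≡ n ⊡ T ⊞ i^ k · P
actPoint-mot n k T P = trans (go k) (cong (n ⊡ T ⊞_) (rot≡i^ k P))
  where
  go : ∀ k → actPoint n (mot k T) P ≡ n ⊡ T ⊞ rot k P
  go 0F = refl
  go 1F = refl
  go 2F = refl
  go 3F = refl

interval-∘ : ∀ h k i → interval (h ∘₁ k) i ≡ interval h (interval k i)
interval-∘ (pos s) (pos t) i = ℤ.+-assoc s t i
interval-∘ (pos s) (neg t) i = lemma s t i
  where
  lemma : ∀ s t i → s + t - 1ℤ - i ≡ s + (t - 1ℤ - i)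
  lemma = solve-∀ ℤSolver.ring
interval-∘ (neg s) (pos t) i = lemma s t i
  where
  lemma : ∀ s t i → s - t - 1ℤ - i ≡ s - 1ℤ - (t + i)
  lemma = solve-∀ ℤSolver.ring
interval-∘ (neg s) (neg t) i = lemma s t i
  where
  lemma : ∀ s t i → s - t + i ≡ s - 1ℤ - (t - 1ℤ - i)
  lemma = solve-∀ ℤSolver.ring

actStrand-∘ : ∀ g h r → actStrand (g ∘₂ h) r ≡ actStrand g (actStrand h r)
actStrand-∘ (straight h k) (straight h′ k′) (warp i) = cong warp (interval-∘ h h′ i)
actStrand-∘ (straight h k) (straight h′ k′) (weft j) = cong weft (interval-∘ k k′ j)
actStrand-∘ (straight h k) (swapped  h′ k′) (warp i) = cong weft (interval-∘ k k′ i)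
actStrand-∘ (straight h k) (swapped  h′ k′) (weft j) = cong warp (interval-∘ h h′ j)
actStrand-∘ (swapped  h k) (straight h′ k′) (warp i) = cong weft (interval-∘ k h′ i)
actStrand-∘ (swapped  h k) (straight h′ k′) (weft j) = cong warp (interval-∘ h k′ j)
actStrand-∘ (swapped  h k) (swapped  h′ k′) (warp i) = cong warp (interval-∘ h k′ i)
actStrand-∘ (swapped  h k) (swapped  h′ k′) (weft j) = cong weft (interval-∘ k h′ j)

-- The group generated by the quarter-turns about two neighbouring centres

δ : Fin 4 → Index
δ 0F = 𝟘
δ 1F = 𝟙
δ 2F = 1ℤ , 1ℤ
δ 3F = 0ℤ , 1ℤ

δ-next : ∀ s → δ (next s) ≡ δ s ⊞ i^ s
δ-next = from-yes (Fin.all? λ s → δ (next s) ≟ᴾ δ s ⊞ i^ s)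

-- Hence z ↦ y + iᵏz takes the corner `w ⊞ δ s` to the corner numbered `k ⊕ s` of the unit y + iᵏw -
-- `δ k`: it permutes units and shifts the numbers of their sides by k.
δ-⊕ : ∀ k s → δ (k ⊕ s) ≡ δ k ⊞ i^ k · δ s
δ-⊕ = from-yes (Fin.all? λ k → Fin.all? λ s → δ (k ⊕ s) ≟ᴾ δ k ⊞ i^ k · δ s)

module Lattice (o : Point) (a b : ℤ) where
  open Tiling o a b

  C : Index → Point
  C z = o ⊞ z · u

  -- The second generator `v` is i times `u`, so the combination m, n of the two is a single product
  -- with m + ni.
  corner≡C : ∀ z → corner z ≡ C z
  corner≡C (m , n) = cong₂ _,_ (fst (proj₁ o) m n _ _) (snd (proj₂ o) m n _ _)
    where
    fst : ∀ x m n s t → x + m * s + n * - t ≡ x + (m * s - n * t)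
    fst = solve-∀ ℤSolver.ring
    snd : ∀ y m n s t → y + m * t + n * s ≡ y + (m * t + n * s)
    snd = solve-∀ ℤSolver.ring

  start≡C : ∀ w s → start w s ≡ C (w ⊞ δ s)
  start≡C w@(m , n) s = trans (go s) (corner≡C (w ⊞ δ s))
    where
    go : ∀ s → start w s ≡ corner (w ⊞ δ s)
    go 0F = sym (cong₂ (λ x y → corner (x , y)) (ℤ.+-identityʳ m) (ℤ.+-identityʳ n))
    go 1F = sym (cong (λ y → corner (m + 1ℤ , y)) (ℤ.+-identityʳ n))
    go 2F = refl
    go 3F = sym (cong (λ x → corner (x , n + 1ℤ)) (ℤ.+-identityʳ m))

  end≡C : ∀ w s → end w s ≡ C (w ⊞ δ s ⊞ i^ s)
  end≡C w s = trans (start≡C w (next s))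
    (cong C (trans (cong (w ⊞_) (δ-next s)) (assoc w (δ s) (i^ s))))
    where
    assoc : ∀ x y z → x ⊞ (y ⊞ z) ≡ x ⊞ y ⊞ z
    assoc = solve-∀ gaussianRing

  -- γ k z is the rotation through k quarter-turns that takes o to the
  -- corner z; it takes the corner y to the corner z + iᵏy.
  γ : Fin 4 → Index → Isometry
  γ k z = mot k (C z ⊟ i^ k · o)

  -- The given pair of corners matters only through the image of the corner 0, which is z - iᵏy.
  motion≡γ : ∀ k y z → motion k (C y) (C z) ≡ γ k (z ⊟ i^ k · y)
  motion≡γ k y z = trans (motion≡mot k (C y) (C z)) (cong (mot k) (lemma o y z u (i^ k)))
    where
    lemma : ∀ o y z u i → (o ⊞ z · u) ⊞ ~ (i · (o ⊞ y · u)) ≡ o ⊞ (z ⊞ ~ (i · y)) · u ⊞ ~ (i · o)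
    lemma = solve-∀ gaussianRing

  -- A rotation is determined by its angle and its effect on one corner.
  motion-cong : ∀ k y z y′ z′ → z ⊟ i^ k · y ≡ z′ ⊟ i^ k · y′ →
                motion k (C y) (C z) ≡ motion k (C y′) (C z′)
  motion-cong k y z y′ z′ eq =
    trans (motion≡γ k y z) (trans (cong (γ k) eq) (sym (motion≡γ k y′ z′)))

  -- The law of the semidirect product of ℤ[i] with its group of units, so these rotations form a
  -- group.
  γ-∘ : ∀ k y l z → γ k y ∘₂ γ l z ≡ γ (k ⊕ l) (y ⊞ i^ k · z)
  γ-∘ k y l z = trans (mot-∘ k _ l _) (cong (mot (k ⊕ l)) (begin
    C y ⊟ i^ k · o ⊞ i^ k · (C z ⊟ i^ l · o)       ≡⟨ lemma o y z u (i^ k) (i^ l) ⟩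
    C (y ⊞ i^ k · z) ⊟ (i^ k · i^ l) · o           ≡⟨ cong (λ i → C (y ⊞ i^ k · z) ⊟ i · o) (i^-⊕ k l) ⟨
    C (y ⊞ i^ k · z) ⊟ i^ (k ⊕ l) · o              ∎))
    where
    lemma : ∀ o y z u i j → o ⊞ y · u ⊞ ~ (i · o) ⊞ i · (o ⊞ z · u ⊞ ~ (j · o)) ≡
                            o ⊞ (y ⊞ i · z) · u ⊞ ~ (i · j · o)
    lemma = solve-∀ gaussianRing

  γ-inverse : ∀ k z → inv₂ (γ k z) ≡ γ (⊖ k) (~ (i^ (⊖ k) · z))
  γ-inverse k z = trans (mot-inverse k _) (cong (mot (⊖ k)) (begin
    ~ (i^ (⊖ k) · (C z ⊟ i^ k · o))                          ≡⟨ lemma o z u (i^ (⊖ k)) (i^ k) ⟩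
    i^ (⊖ k) · i^ k · o ⊞ (~ (i^ (⊖ k) · z)) · u ⊟ i^ (⊖ k) · o
      ≡⟨ cong (λ j → j · o ⊞ (~ (i^ (⊖ k) · z)) · u ⊟ i^ (⊖ k) · o) (i^-⊖ k) ⟩
    𝟙 · o ⊞ (~ (i^ (⊖ k) · z)) · u ⊟ i^ (⊖ k) · o            ≡⟨ unit-law o _ _ ⟩
    C (~ (i^ (⊖ k) · z)) ⊟ i^ (⊖ k) · o                      ∎))
    where
    lemma : ∀ o z u j i → ~ (j · (o ⊞ z · u ⊞ ~ (i · o))) ≡ j · i · o ⊞ (~ (j · z)) · u ⊞ ~ (j · o)
    lemma = solve-∀ gaussianRing
    unit-law : ∀ o y z → 𝟙 · o ⊞ y ⊞ ~ z ≡ o ⊞ y ⊞ ~ z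
    unit-law = solve-∀ gaussianRing

  γ-identity : γ 0F 𝟘 ≡ idᵢ
  γ-identity = cong (mot 0F) (lemma o u)
    where
    lemma : ∀ o u → o ⊞ 𝟘 · u ⊞ ~ (𝟙 · o) ≡ 𝟘
    lemma = solve-∀ gaussianRing

  actPoint-γ : ∀ k z y → actPoint 1ℤ (γ k z) (C y) ≡ C (z ⊞ i^ k · y)
  actPoint-γ k z y = begin
    actPoint 1ℤ (γ k z) (C y)                       ≡⟨ actPoint-mot 1ℤ k _ (C y) ⟩
    1ℤ ⊡ (C z ⊟ i^ k · o) ⊞ i^ k · C y              ≡⟨ cong (_⊞ i^ k · C y) (⊡-identityˡ (C z ⊟ i^ k · o)) ⟩
    C z ⊟ i^ k · o ⊞ i^ k · C y                     ≡⟨ lemma o z y u (i^ k) ⟩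
    C (z ⊞ i^ k · y)                                ∎
    where
    ⊡-identityˡ : ∀ P → 1ℤ ⊡ P ≡ P
    ⊡-identityˡ (x , y) = cong₂ _,_ (ℤ.*-identityˡ x) (ℤ.*-identityˡ y)
    lemma : ∀ o z y u i → o ⊞ z · u ⊞ ~ (i · o) ⊞ i · (o ⊞ y · u) ≡ o ⊞ (z ⊞ i · y) · u
    lemma = solve-∀ gaussianRing

  γ-cancelˡ : ∀ k z r → actStrand (γ (⊖ k) (~ (i^ (⊖ k) · z))) (actStrand (γ k z) r) ≡ r
  γ-cancelˡ k z r = begin
    actStrand (γ (⊖ k) (~ (i^ (⊖ k) · z))) (actStrand (γ k z) r)
      ≡⟨ actStrand-∘ (γ (⊖ k) (~ (i^ (⊖ k) · z))) (γ k z) r ⟨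
    actStrand (γ (⊖ k) (~ (i^ (⊖ k) · z)) ∘₂ γ k z) r
      ≡⟨ cong (λ g → actStrand g r) (γ-∘ (⊖ k) (~ (i^ (⊖ k) · z)) k z) ⟩
    actStrand (γ (⊖ k ⊕ k) (~ (i^ (⊖ k) · z) ⊞ i^ (⊖ k) · z)) r
      ≡⟨ cong₂ (λ l y → actStrand (γ l y) r) (⊖-⊕ k) (lemma (i^ (⊖ k) · z)) ⟩
    actStrand (γ 0F 𝟘) r
      ≡⟨ cong (λ g → actStrand g r) γ-identity ⟩
    actStrand idᵢ r
      ≡⟨ identity r ⟩
    r ∎
    where
    lemma : ∀ y → ~ y ⊞ y ≡ 𝟘
    lemma = solve-∀ gaussianRing
    identity : ∀ r → actStrand idᵢ r ≡ r
    identity (warp i) = cong warp (ℤ.+-identityˡ i)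
    identity (weft j) = cong weft (ℤ.+-identityˡ j)

  -- Here `o′` is a neighbouring centre of the other family, and the quarter-turn about it takes the
  -- corner y to ηi + iy. The sign η depends on which of c and d serves as `o`.
  module Group (o′ : Point) (η : ℤ) (η-unit : η ≡ 1ℤ ⊎ η ≡ -1ℤ)
    (o′-turn : motion 1F o′ o′ ≡ γ 1F (0ℤ , η)) where

    G : Symmetry → Set
    G = Generated (quarterTurn o) (quarterTurn o′)

    o-turn : motion 1F o o ≡ γ 1F 𝟘
    o-turn = trans (motion≡mot 1F o o) (cong (mot 1F) (lemma o u (i^ 1F)))
      where
      lemma : ∀ o u i → o ⊞ ~ (i · o) ≡ o ⊞ 𝟘 · u ⊞ ~ (i · o)
      lemma = solve-∀ gaussianRing

    generated⇒γ : ∀ {σ} → G σ → ∃[ k ] ∃[ z ] proj₁ σ ≡ γ k z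
    generated⇒γ gen₁ = 1F , 𝟘 , o-turn
    generated⇒γ gen₂ = 1F , (0ℤ , η) , o′-turn
    generated⇒γ unit = 0F , 𝟘 , sym γ-identity
    generated⇒γ (comp p q) with generated⇒γ p | generated⇒γ q
    ... | k , y , g≡ | l , z , h≡ = k ⊕ l , y ⊞ i^ k · z , trans (cong₂ _∘₂_ g≡ h≡) (γ-∘ k y l z)
    generated⇒γ (inv p) with generated⇒γ p
    ... | k , z , g≡ = ⊖ k , ~ (i^ (⊖ k) · z) , trans (cong inv₂ g≡) (γ-inverse k z)

    -- A record, so that k and z can be inferred: `γ k z` itself unfolds by cases on k.
    record Gγ (k : Fin 4) (z : Index) : Set where
      constructor ⟨_⟩
      field generated : G (γ k z , e)

    compγ : ∀ {k l y z} → Gγ k y → Gγ l z → Gγ (k ⊕ l) (y ⊞ i^ k · z)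
    compγ {k} {l} {y} {z} ⟨ p ⟩ ⟨ q ⟩ = ⟨ subst (λ g → G (g , e)) (γ-∘ k y l z) (comp p q) ⟩

    turn₁ : Gγ 1F 𝟘
    turn₁ = ⟨ subst (λ g → G (g , e)) o-turn gen₁ ⟩

    turns : ∀ k → Gγ k 𝟘
    turns 0F = ⟨ subst (λ g → G (g , e)) (sym γ-identity) unit ⟩
    turns 1F = turn₁
    turns 2F = compγ turn₁ turn₁
    turns 3F = compγ turn₁ (turns 2F)

    add : ∀ {y z} → Gγ 0F y → Gγ 0F z → Gγ 0F (y ⊞ z)
    add {y} {z} p q = subst (Gγ 0F) (lemma y z) (compγ p q)
      where
      lemma : ∀ y z → y ⊞ 𝟙 · z ≡ y ⊞ z
      lemma = solve-∀ gaussianRing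

    -- Conjugating a translation by the quarter-turn about `o` multiplies it by i.
    rotate : ∀ {z} → Gγ 0F z → Gγ 0F ((0ℤ , 1ℤ) · z)
    rotate {z} p = subst (Gγ 0F) (lemma (i^ 1F) z) (compγ (compγ turn₁ p) (turns 3F))
      where
      lemma : ∀ i z → 𝟘 ⊞ i · z ⊞ i · 𝟘 ≡ i · z
      lemma = solve-∀ gaussianRing

    -- The quarter-turn about `o′` after the opposite one about `o` is the translation ηi; one or
    -- three multiplications by i make it 1.
    basis : Gγ 0F 𝟙
    basis = case η-unit of λ where
        (inj₁ refl) → rotate (rotate (rotate shift₁))
        (inj₂ refl) → rotate shift₁
      where
      shift₁ : Gγ 0F (0ℤ , η)
      shift₁ = subst (Gγ 0F) (lemma (0ℤ , η))
        (compγ {1F} {3F} {0ℤ , η} {𝟘} ⟨ subst (λ g → G (g , e)) o′-turn gen₂ ⟩ (turns 3F))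
        where
        lemma : ∀ z → z ⊞ (0ℤ , 1ℤ) · 𝟘 ≡ z
        lemma = solve-∀ gaussianRing

    multiples : ∀ n → Gγ 0F (+ n , 0ℤ)
    multiples ℕ.zero    = turns 0F
    multiples (ℕ.suc n) = add basis (multiples n)

    horizontal : ∀ m → Gγ 0F (m , 0ℤ)
    horizontal (+ n)    = multiples n
    horizontal -[1+ n ] = subst (Gγ 0F) (lemma (+ ℕ.suc n , 0ℤ)) (rotate (rotate (multiples (ℕ.suc n))))
      where
      lemma : ∀ z → (0ℤ , 1ℤ) · ((0ℤ , 1ℤ) · z) ≡ ~ z
      lemma = solve-∀ gaussianRing

    γ∈G : ∀ k z → Gγ k z
    γ∈G k z@(m , n) = subst (Gγ k) (lemma z) (compγ translation (turns k))
      where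
      split : ∀ m n → (m , 0ℤ) ⊞ (0ℤ , 1ℤ) · (n , 0ℤ) ≡ (m , n)
      split m n = cong₂ _,_ (fst m n) (snd n)
        where
        fst : ∀ m n → m + (0ℤ * n - 1ℤ * 0ℤ) ≡ m
        fst = solve-∀ ℤSolver.ring
        snd : ∀ n → 0ℤ + (0ℤ * 0ℤ + 1ℤ * n) ≡ n
        snd = solve-∀ ℤSolver.ring
      translation : Gγ 0F z
      translation = subst (Gγ 0F) (split m n) (add (horizontal m) (rotate (horizontal n)))
      lemma : ∀ z → z ⊞ 𝟙 · 𝟘 ≡ z
      lemma = solve-∀ gaussianRing

-- `Group` takes the turn about `o` as first generator; this adapts it to the case that `o` is d.
generated-swap : ∀ {σ₁ σ₂ σ} → Generated σ₁ σ₂ σ → Generated σ₂ σ₁ σ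
generated-swap gen₁       = gen₂
generated-swap gen₂       = gen₁
generated-swap unit       = unit
generated-swap (comp p q) = comp (generated-swap p) (generated-swap q)
generated-swap (inv p)    = inv (generated-swap p)

record SymmetryGroup (F : Prefabric) (o : Point) (a b : ℤ) : Set where
  open Lattice o a b
  field
    γ-symmetry : ∀ k z → IsSymmetry F (γ k z , e)
    symmetry-γ : ∀ {g η} → IsSymmetry F (g , η) → ∃[ k ] ∃[ z ] g ≡ γ k z

module _ (o : Point) (a b : ℤ) where
  open Lattice o a b

  -- The quarter-turn about `o′` takes `o` to o + (1 - i)(o′ - o), so the hypothesis says that this
  -- image is the corner ηi.
  neighbouring-turn : ∀ o′ η → (𝟙 ⊞ ~ (0ℤ , 1ℤ)) · (o′ ⊟ o) ≡ (0ℤ , η) · Tiling.u o a b →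
                      motion 1F o′ o′ ≡ γ 1F (0ℤ , η)
  neighbouring-turn o′ η eq = trans (motion≡mot 1F o′ o′) (cong (mot 1F) (begin
    o′ ⊟ i^ 1F · o′                                ≡⟨ lemma o o′ (i^ 1F) ⟩
    o ⊞ (𝟙 ⊞ ~ i^ 1F) · (o′ ⊟ o) ⊟ i^ 1F · o       ≡⟨ cong (λ P → o ⊞ P ⊟ i^ 1F · o) eq ⟩
    C (0ℤ , η) ⊟ i^ 1F · o                         ∎))
    where
    lemma : ∀ o o′ i → o′ ⊞ ~ (i · o′) ≡ o ⊞ (𝟙 ⊞ ~ i) · (o′ ⊞ ~ o) ⊞ ~ (i · o)
    lemma = solve-∀ gaussianRing

module _ {F : Prefabric} {c d : Point} {a b : ℤ} (species : Species33₄ F c d a b) where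
  open Species33₄ species

  symmetryGroup : ∀ {o} → o ≡ c ⊎ o ≡ d → SymmetryGroup F o a b
  symmetryGroup (inj₁ refl) = record
    { γ-symmetry = λ k z → Equivalence.from (group _) (Gγ.generated (γ∈G k z))
    ; symmetry-γ = λ σ → generated⇒γ (Equivalence.to (group _) σ) }
    where
    open Lattice c a b
    fst : ∀ a b → (1ℤ + - 0ℤ) * (+ 2 * a) - (0ℤ + -1ℤ) * (+ 2 * b) ≡ 0ℤ * (+ 2 * (a - b)) - -1ℤ * (+ 2 * (a + b))
    fst = solve-∀ ℤSolver.ring
    snd : ∀ a b → (1ℤ + - 0ℤ) * (+ 2 * b) + (0ℤ + -1ℤ) * (+ 2 * a) ≡ 0ℤ * (+ 2 * (a + b)) + -1ℤ * (+ 2 * (a - b))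
    snd = solve-∀ ℤSolver.ring
    -- The sign comes from (1 - i)(2a + 2bi) = - iu. Seen from d the separation is negated, and with
    -- it η.
    open Group d -1ℤ (inj₂ refl) (neighbouring-turn c a b d -1ℤ
      (trans (cong ((𝟙 ⊞ ~ (0ℤ , 1ℤ)) ·_) separation) (cong₂ _,_ (fst a b) (snd a b))))
  symmetryGroup (inj₂ refl) = record
    { γ-symmetry = λ k z → Equivalence.from (group _) (generated-swap (Gγ.generated (γ∈G k z)))
    ; symmetry-γ = λ σ → generated⇒γ (generated-swap (Equivalence.to (group _) σ)) }
    where
    open Lattice d a b
    fst : ∀ a b → (1ℤ + - 0ℤ) * - (+ 2 * a) - (0ℤ + -1ℤ) * - (+ 2 * b) ≡ 0ℤ * (+ 2 * (a - b)) - 1ℤ * (+ 2 * (a + b))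
    fst = solve-∀ ℤSolver.ring
    snd : ∀ a b → (1ℤ + - 0ℤ) * - (+ 2 * b) + (0ℤ + -1ℤ) * - (+ 2 * a) ≡ 0ℤ * (+ 2 * (a + b)) + 1ℤ * (+ 2 * (a - b))
    snd = solve-∀ ℤSolver.ring
    reverse : ∀ c d → c ⊞ ~ d ≡ ~ (d ⊞ ~ c)
    reverse = solve-∀ gaussianRing
    open Group c 1ℤ (inj₁ refl) (neighbouring-turn d a b c 1ℤ
      (trans (cong ((𝟙 ⊞ ~ (0ℤ , 1ℤ)) ·_) (trans (reverse c d) (cong ~_ separation)))
        (cong₂ _,_ (fst a b) (snd a b))))

-- Action of the rotations on strands spanned by two points

module _ {o : Point} {a b : ℤ} where
  open Tiling o a b
  open Lattice o a b

  Between-interval : ∀ h {x x′ i} → Between x x′ i → Between (act₁ 1ℤ h x) (act₁ 1ℤ h x′) (interval h i)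
  Between-interval (pos t) rewrite ℤ.*-identityˡ t = Sum.map translate translate
    where
    translate : ∀ {x x′ i} → x ≤ i × i < x′ → t + x ≤ t + i × t + i < t + x′
    translate = Product.map (ℤ.+-monoʳ-≤ t) (ℤ.+-monoʳ-< t)
  Between-interval (neg t) rewrite ℤ.*-identityˡ t = λ p → Sum.swap (Sum.map reflect reflect p)
    where
    1+ : ∀ t i → t - (1ℤ + i) ≡ t - 1ℤ - i
    1+ = solve-∀ ℤSolver.ring
    cancel : ∀ t i → t - i ≡ 1ℤ + (t - 1ℤ - i)
    cancel = solve-∀ ℤSolver.ring
    -- A unit interval is named by its lower end, so a reflection exchanges the strict and the weak
    -- bound, at the cost of the 1 in `interval`.
    reflect : ∀ {x x′ i} → x ≤ i × i < x′ → t - x′ ≤ t - 1ℤ - i × t - 1ℤ - i < t - x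
    reflect {x} {x′} {i} (x≤i , i<x′) =
        subst (t - x′ ≤_) (1+ t i) (ℤ.+-monoʳ-≤ t (ℤ.neg-mono-≤ (ℤ.i<j⇒suc[i]≤j i<x′)))
      , ℤ.suc[i]≤j⇒i<j (subst (_≤ t - x) (cancel t i) (ℤ.+-monoʳ-≤ t (ℤ.neg-mono-≤ x≤i)))

  SpannedBy-sym : ∀ {P Q} r → SpannedBy P Q r → SpannedBy Q P r
  SpannedBy-sym (warp i) = Sum.swap
  SpannedBy-sym (weft j) = Sum.swap

  SpannedBy-act : ∀ g {P Q} r → SpannedBy P Q r →
                  SpannedBy (actPoint 1ℤ g P) (actPoint 1ℤ g Q) (actStrand g r)
  SpannedBy-act (straight h k) (warp i) = Between-interval h
  SpannedBy-act (straight h k) (weft j) = Between-interval k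
  SpannedBy-act (swapped  h k) (warp i) = Between-interval k
  SpannedBy-act (swapped  h k) (weft j) = Between-interval h

  SpannedBy-γ : ∀ k z y y′ r → SpannedBy (C y) (C y′) r →
                SpannedBy (C (z ⊞ i^ k · y)) (C (z ⊞ i^ k · y′)) (actStrand (γ k z) r)
  SpannedBy-γ k z y y′ r p = subst₂ (λ P Q → SpannedBy P Q (actStrand (γ k z) r))
    (actPoint-γ k z y) (actPoint-γ k z y′) (SpannedBy-act (γ k z) r p)

-- Flags and rotations of the cube

private
  code : Face → Fin 6
  code +x = 0F
  code -x = 1F
  code +y = 2F
  code -y = 3F
  code +z = 4F
  code -z = 5F

  decode : Fin 6 → Face
  decode 0F = +x
  decode 1F = -x
  decode 2F = +y
  decode 3F = -y
  decode 4F = +z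
  decode 5F = -z

  decode-code : ∀ f → decode (code f) ≡ f
  decode-code +x = refl
  decode-code -x = refl
  decode-code +y = refl
  decode-code -y = refl
  decode-code +z = refl
  decode-code -z = refl

infix 4 _≟ᶠ_

_≟ᶠ_ : DecidableEquality Face
f ≟ᶠ g = map′ (λ eq → trans (sym (decode-code f)) (trans (cong decode eq) (decode-code g)))
              (cong code) (code f Fin.≟ code g)

-- Through the coding by `Fin 6`, statements about all faces and all flags can be decided by
-- exhaustion, and the combinatorial facts about the cube are obtained in this way.
allFaces? : {P : Face → Set} → (∀ f → Dec (P f)) → Dec (∀ f → P f)
allFaces? {P} P? = map′ (λ p f → subst P (decode-code f) (p (code f))) (_∘ decode)
                        (Fin.all? (P? ∘ decode))

_⟂?_ : ∀ f t → Dec (f ⟂ t)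
f ⟂? t = ¬? (t ≟ᶠ f) ×-dec ¬? (t ≟ᶠ antipode f)

allFlags? : {P : Face → Face → Set} → (∀ f t → Dec (P f t)) → Dec (∀ f t → f ⟂ t → P f t)
allFlags? P? = allFaces? λ f → allFaces? λ t → f ⟂? t →-dec P? f t

turns : Fin 4 → Face → Face → Face
turns 0F f t = t
turns 1F f t = turn f t
turns 2F f t = turn f (turn f t)
turns 3F f t = turn f (turn f (turn f t))

⟂-turn : ∀ f t → f ⟂ t → f ⟂ turn f t
⟂-turn = from-yes (allFlags? λ f t → f ⟂? turn f t)

⟂-sym : ∀ f t → f ⟂ t → t ⟂ f
⟂-sym = from-yes (allFlags? λ f t → t ⟂? f)

antipode≡turn² : ∀ f t → f ⟂ t → antipode t ≡ turn f (turn f t)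
antipode≡turn² = from-yes (allFlags? λ f t → antipode t ≟ᶠ turn f (turn f t))

⟂⇒⟂antipode : ∀ f t → f ⟂ t → t ⟂ antipode f
⟂⇒⟂antipode = from-yes (allFlags? λ f t → t ⟂? antipode f)

turns-transitive : ∀ f t → f ⟂ t → ∀ t′ → f ⟂ t′ → ∃[ k ] turns k f t ≡ t′
turns-transitive = from-yes (allFlags? λ f t → allFaces? λ t′ → f ⟂? t′ →-dec
  Fin.any? λ k → turns k f t ≟ᶠ t′)

antipode-≢ : ∀ f → antipode f ≢ f
antipode-≢ = from-yes (allFaces? λ f → ¬? (antipode f ≟ᶠ f))

turn-self : ∀ f → turn f f ≡ f
turn-self = from-yes (allFaces? λ f → turn f f ≟ᶠ f)

turn-antipode : ∀ f → turn f (antipode f) ≡ antipode f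
turn-antipode = from-yes (allFaces? λ f → turn f (antipode f) ≟ᶠ antipode f)

neighbourOf : ∀ f → ∃[ t ] f ⟂ t
neighbourOf = from-yes (allFaces? λ f → map′ (λ (i , p) → decode i , p)
  (λ (t , p) → code t , subst (f ⟂_) (sym (decode-code t)) p) (Fin.any? λ i → f ⟂? decode i))

module _ (P : Face → Face → Set)
  (P-turn : ∀ {f t} → f ⟂ t → P f t → P f (turn f t)) where

  face-induction : ∀ {f t t′} → f ⟂ t → f ⟂ t′ → P f t → P f t′
  face-induction {f} {t} {t′} f⟂t f⟂t′ p with turns-transitive f t f⟂t t′ f⟂t′
  ... | k , refl = go k
    where
    f⟂t₁ = ⟂-turn f t f⟂t
    p₁ = P-turn f⟂t p
    p₂ = P-turn f⟂t₁ p₁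
    go : ∀ k → P f (turns k f t)
    go 0F = p
    go 1F = p₁
    go 2F = p₂
    go 3F = P-turn (⟂-turn f (turn f t) f⟂t₁) p₂

  module _ (P-sym : ∀ {f t} → f ⟂ t → P f t → P t f) where

    private
      across : ∀ {f t f′ t′} → f ⟂ t → f ⟂ f′ → f′ ⟂ t′ → P f t → P f′ t′
      across {f} {t} {f′} f⟂t f⟂f′ f′⟂t′ p =
        face-induction (⟂-sym f f′ f⟂f′) f′⟂t′ (P-sym f⟂f′ (face-induction f⟂t f⟂f′ p))

    -- Turning reaches all flags of a face, and reversing a flag leads to an adjacent face. The
    -- antipodal face is two such steps away, through t.
    flag-induction : ∀ {f t f′ t′} → f ⟂ t → f′ ⟂ t′ → P f t → P f′ t′
    flag-induction {f} {t} {f′} f⟂t f′⟂t′ p with f′ ≟ᶠ f | f′ ≟ᶠ antipode f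
    ... | yes refl | _        = face-induction f⟂t f′⟂t′ p
    ... | no f′≢f  | no f′≢-f = across f⟂t (f′≢f , f′≢-f) f′⟂t′ p
    ... | no _     | yes refl =
      across (⟂-sym f t f⟂t) (⟂⇒⟂antipode f t f⟂t) f′⟂t′ (P-sym f⟂t p)

-- The flag (f , t) stands for the vertex at which the edge of f towards t
-- starts, that is the vertex common to f, t and turn³ f t.  Vertices are
-- coloured alternately, by the product of the signs of their three faces.
vertexColour : Face → Face → Colour
vertexColour f t = sign f (sign t (sign (turns 3F f t) dark))
  where
  sign : Face → Colour → Colour
  sign +x = λ c → c
  sign +y = λ c → c
  sign +z = λ c → c
  sign -x = flip
  sign -y = flip
  sign -z = flip

infix 4 _≟ᶜ_

_≟ᶜ_ : DecidableEquality Colour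
dark ≟ᶜ dark = yes refl
dark ≟ᶜ pale = no λ ()
pale ≟ᶜ dark = no λ ()
pale ≟ᶜ pale = yes refl

vertexColour-turn : ∀ f t → f ⟂ t → vertexColour f (turn f t) ≡ flip (vertexColour f t)
vertexColour-turn = from-yes (allFlags? λ f t → vertexColour f (turn f t) ≟ᶜ flip (vertexColour f t))

vertexColour-sym : ∀ f t → f ⟂ t → vertexColour t f ≡ flip (vertexColour f t)
vertexColour-sym = from-yes (allFlags? λ f t → vertexColour t f ≟ᶜ flip (vertexColour f t))

-- If the images lay on one axis, the turn about the image of f would fix the image of t. But two
-- turns about f bring t to its antipode, and no face is its own antipode.
to-⟂ : ∀ R {f t} → f ⟂ t → to R f ⟂ to R t
to-⟂ R {f} {t} f⟂t =
    (λ eq → fixed (trans (cong (λ g → turn g (to R t)) (sym eq)) (turn-self (to R t))))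
  , (λ eq → fixed (trans (cong (turn (to R f)) eq) (trans (turn-antipode (to R f)) (sym eq))))
  where
  fixed : turn (to R f) (to R t) ≢ to R t
  fixed eq = antipode-≢ (to R t) (begin
    antipode (to R t)                     ≡⟨ to-antipode R t ⟨
    to R (antipode t)                     ≡⟨ cong (to R) (antipode≡turn² f t f⟂t) ⟩
    to R (turn f (turn f t))              ≡⟨ to-turn R f (turn f t) ⟩
    turn (to R f) (to R (turn f t))       ≡⟨ cong (turn (to R f)) (trans (to-turn R f t) eq) ⟩
    turn (to R f) (to R t)                ≡⟨ eq ⟩
    to R t                                ∎)

-- The rotation that carries the flag (+z , +x) to (f , t), and its inverse.
frame coframe : Face → Face → Face → Face
frame f t +x = t
frame f t -x = antipode t
frame f t +y = turn f t
frame f t -y = antipode (turn f t)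
frame f t +z = f
frame f t -z = antipode f
coframe f t g =
  if does (g ≟ᶠ f) then +z else if does (g ≟ᶠ antipode f) then -z else
  if does (g ≟ᶠ t) then +x else if does (g ≟ᶠ antipode t) then -x else
  if does (g ≟ᶠ turn f t) then +y else -y

IsRotation : (Face → Face) → Set
IsRotation R = (∀ f → R (antipode f) ≡ antipode (R f)) × (∀ f t → R (turn f t) ≡ turn (R f) (R t))

isRotation? : ∀ R → Dec (IsRotation R)
isRotation? R = (allFaces? λ f → R (antipode f) ≟ᶠ antipode (R f)) ×-dec
                (allFaces? λ f → allFaces? λ t → R (turn f t) ≟ᶠ turn (R f) (R t))

frame-rotation : ∀ f t → f ⟂ t → IsRotation (frame f t)
frame-rotation = from-yes (allFlags? λ f t → isRotation? (frame f t))

coframe-rotation : ∀ f t → f ⟂ t → IsRotation (coframe f t)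
coframe-rotation = from-yes (allFlags? λ f t → isRotation? (coframe f t))

coframe-flag : ∀ f t → f ⟂ t → coframe f t f ≡ +z × coframe f t t ≡ +x
coframe-flag = from-yes (allFlags? λ f t → (coframe f t f ≟ᶠ +z) ×-dec (coframe f t t ≟ᶠ +x))

-- Going through one reference flag leaves 24 frames and 24 coframes to be checked, instead of all
-- 576 pairs of flags.
rotation : ∀ {f t f′ t′} → f ⟂ t → f′ ⟂ t′ → Σ CubeRotation λ R → to R f ≡ f′ × to R t ≡ t′
rotation {f} {t} {f′} {t′} f⟂t f′⟂t′ =
  record { to          = λ g → M (N g)
         ; to-antipode = λ g → trans (cong M (N-antipode g)) (M-antipode (N g))
         ; to-turn     = λ g h → trans (cong M (N-turn g h)) (M-turn (N g) (N h)) }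
  , cong M (proj₁ (coframe-flag f t f⟂t)) , cong M (proj₂ (coframe-flag f t f⟂t))
  where
  M N : Face → Face
  M = frame f′ t′
  N = coframe f t
  M-antipode = proj₁ (frame-rotation f′ t′ f′⟂t′)
  M-turn     = proj₂ (frame-rotation f′ t′ f′⟂t′)
  N-antipode = proj₁ (coframe-rotation f t f⟂t)
  N-turn     = proj₂ (coframe-rotation f t f⟂t)

-- Following a strand through the tiling

-- A strand in the i-th place passes through the units across the sides
-- whose ends lie at levels on different sides of it, the level of a corner
-- being its coordinate transverse to the strand.
module _ (i : ℤ) where

  open Tiling 𝟘 0ℤ 0ℤ using (Between)

  level : ℤ → ℤ → ℤ → Index → ℤ
  level ℓ A B (m , n) = ℓ + (m * A + n * B)

  PassesSide : (ℓ A B : ℤ) → Index → Fin 4 → Set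
  PassesSide ℓ A B z s = Between (level ℓ A B (z ⊞ δ s)) (level ℓ A B (z ⊞ δ (next s))) i

  Passes : (ℓ A B : ℤ) → Index → Set
  Passes ℓ A B z = ∃[ s ] PassesSide ℓ A B z s

  -- The side s runs in the direction `i^ s` with the unit on its left, so the step across it is the
  -- direction turned clockwise, `i^ (3F ⊕ s)`.
  Follows : (ℓ A B : ℤ) → (Index → Set) → Set
  Follows ℓ A B S = ∀ s z → PassesSide ℓ A B z s → S z → S (z ⊞ i^ (3F ⊕ s))

  -- The map y ↦ 1 + iy of corners takes the unit z to the unit iz and its side s to `next s`. The
  -- 1, which keeps the first corner of a unit in its place, is what turns ℓ into ℓ + A.
  level-rotate : ∀ ℓ A B z → level (ℓ + A) B (- A) z ≡ level ℓ A B (𝟙 ⊞ i^ 1F · z)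
  level-rotate ℓ A B (m , n) = lemma ℓ A B m n
    where
    lemma : ∀ ℓ A B m n → ℓ + A + (m * B + n * - A) ≡
                          ℓ + ((1ℤ + (0ℤ * m - 1ℤ * n)) * A + (0ℤ + (0ℤ * n + 1ℤ * m)) * B)
    lemma = solve-∀ ℤSolver.ring

  side-rotate : ∀ ℓ A B z s → level (ℓ + A) B (- A) (z ⊞ δ s) ≡ level ℓ A B (i^ 1F · z ⊞ δ (next s))
  side-rotate ℓ A B z s = trans (level-rotate ℓ A B (z ⊞ δ s)) (cong (level ℓ A B)
    (trans (lemma (i^ 1F) z (δ s)) (cong (i^ 1F · z ⊞_) (sym (δ-⊕ 1F s)))))
    where
    lemma : ∀ j z d → 𝟙 ⊞ j · (z ⊞ d) ≡ j · z ⊞ (𝟙 ⊞ j · d)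
    lemma = solve-∀ gaussianRing

  PassesSide-rotate : ∀ {ℓ A B z s} →
    PassesSide (ℓ + A) B (- A) z s ≡ PassesSide ℓ A B (i^ 1F · z) (next s)
  PassesSide-rotate {ℓ} {A} {B} {z} {s} =
    cong₂ (λ x y → Between x y i) (side-rotate ℓ A B z s) (side-rotate ℓ A B z (next s))

  unrotate : ∀ z → z ≡ i^ 1F · (i^ 3F · z)
  unrotate = lemma
    where
    lemma : ∀ z → z ≡ (0ℤ , 1ℤ) · ((0ℤ , -1ℤ) · z)
    lemma = solve-∀ gaussianRing

  Passes-rotate : ∀ ℓ A B z → Passes ℓ A B z → Passes (ℓ + A) B (- A) (i^ 3F · z)
  Passes-rotate ℓ A B z (s , p) = 3F ⊕ s , subst (λ X → X) (sym (PassesSide-rotate {ℓ} {A} {B} {i^ 3F · z} {3F ⊕ s}))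
    (subst₂ (PassesSide ℓ A B) (unrotate z) (sym (next⁴ s)) p)
    where
    next⁴ : ∀ s → next (3F ⊕ s) ≡ s
    next⁴ 0F = refl
    next⁴ 1F = refl
    next⁴ 2F = refl
    next⁴ 3F = refl

  Follows-rotate : ∀ {ℓ A B S} → Follows ℓ A B S → Follows (ℓ + A) B (- A) (λ z → S (i^ 1F · z))
  Follows-rotate {ℓ} {A} {B} {S} follow s z p q = subst S
    (trans (cong (i^ 1F · z ⊞_) (i^-⊕ 1F (3F ⊕ s))) (lemma (i^ 1F) z (i^ (3F ⊕ s))))
    (follow (next s) (i^ 1F · z) (subst (λ X → X) (PassesSide-rotate {ℓ} {A} {B} {z} {s}) p) q)
    where
    lemma : ∀ j z d → j · z ⊞ j · d ≡ j · (z ⊞ d)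
    lemma = solve-∀ gaussianRing

  -- If levels increase in both directions of the lattice, then of the sides
  -- through which the strand leaves a unit one leads to the unit above or to
  -- the left; so each value of n - m occurs for just one unit (m , n) on
  -- the strand.
  module Rising {ℓ A B : ℤ} (0<A : 0ℤ < A) (0<B : 0ℤ < B) where

    L : Index → ℤ
    L = level ℓ A B

    -- For positive A and B the corners `δ 0F` and `δ 2F` are the lowest and the highest, so this is
    -- the range of levels in the unit.
    Band : Index → Set
    Band z = L z ≤ i × i < L z + (A + B)

    elevation : Fin 4 → ℤ
    elevation 0F = 0ℤ
    elevation 1F = A
    elevation 2F = A + B
    elevation 3F = B

    L-side : ∀ z s → L (z ⊞ δ s) ≡ L z + elevation s
    L-side (m , n) 0F = lemma ℓ A B m n
      where
      lemma : ∀ ℓ A B m n → ℓ + ((m + 0ℤ) * A + (n + 0ℤ) * B) ≡ ℓ + (m * A + n * B) + 0ℤ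
      lemma = solve-∀ ℤSolver.ring
    L-side (m , n) 1F = lemma ℓ A B m n
      where
      lemma : ∀ ℓ A B m n → ℓ + ((m + 1ℤ) * A + (n + 0ℤ) * B) ≡ ℓ + (m * A + n * B) + A
      lemma = solve-∀ ℤSolver.ring
    L-side (m , n) 2F = lemma ℓ A B m n
      where
      lemma : ∀ ℓ A B m n → ℓ + ((m + 1ℤ) * A + (n + 1ℤ) * B) ≡ ℓ + (m * A + n * B) + (A + B)
      lemma = solve-∀ ℤSolver.ring
    L-side (m , n) 3F = lemma ℓ A B m n
      where
      lemma : ∀ ℓ A B m n → ℓ + ((m + 0ℤ) * A + (n + 1ℤ) * B) ≡ ℓ + (m * A + n * B) + B
      lemma = solve-∀ ℤSolver.ring

    B≤A+B : B ≤ A + B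
    B≤A+B = subst (_≤ A + B) (ℤ.+-identityˡ B) (ℤ.+-monoˡ-≤ B (ℤ.<⇒≤ 0<A))

    A≤A+B : A ≤ A + B
    A≤A+B = subst (_≤ A + B) (ℤ.+-identityʳ A) (ℤ.+-monoʳ-≤ A (ℤ.<⇒≤ 0<B))

    0≤A+B : 0ℤ ≤ A + B
    0≤A+B = ℤ.≤-trans (ℤ.<⇒≤ 0<A) A≤A+B

    elevation-bounds : ∀ s → 0ℤ ≤ elevation s × elevation s ≤ A + B
    elevation-bounds 0F = ℤ.≤-refl , 0≤A+B
    elevation-bounds 1F = ℤ.<⇒≤ 0<A , A≤A+B
    elevation-bounds 2F = 0≤A+B , ℤ.≤-refl
    elevation-bounds 3F = ℤ.<⇒≤ 0<B , B≤A+B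

    passes⇒band : ∀ z → Passes ℓ A B z → Band z
    passes⇒band z (s , p) = go s (next s) p
      where
      above : ∀ s → L z ≤ L (z ⊞ δ s)
      above s = subst₂ _≤_ (ℤ.+-identityʳ (L z)) (sym (L-side z s)) (ℤ.+-monoʳ-≤ (L z) (proj₁ (elevation-bounds s)))
      below : ∀ s → L (z ⊞ δ s) ≤ L z + (A + B)
      below s = subst (_≤ L z + (A + B)) (sym (L-side z s)) (ℤ.+-monoʳ-≤ (L z) (proj₂ (elevation-bounds s)))
      go : ∀ s t → Between (L (z ⊞ δ s)) (L (z ⊞ δ t)) i → Band z
      go s t (inj₁ (p , q)) = ℤ.≤-trans (above s) p , ℤ.<-≤-trans q (below t)
      go s t (inj₂ (p , q)) = ℤ.≤-trans (above t) p , ℤ.<-≤-trans q (below s)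

    passes : ∀ z s → Between (L z + elevation s) (L z + elevation (next s)) i → PassesSide ℓ A B z s
    passes z s = subst₂ (λ x y → Between x y i) (sym (L-side z s)) (sym (L-side z (next s)))

    diagonal : Index → ℤ
    diagonal (m , n) = n - m

    -- Units with equal n - m differ by a multiple of 1 + i, hence in level by a multiple of A + B,
    -- which is the whole height of a band.
    band-unique : ∀ z z′ → Band z → Band z′ → diagonal z ≡ diagonal z′ → z ≡ z′
    band-unique z@(m , n) z′@(m′ , n′) (p , q) (p′ , q′) D≡ =
      cong₂ _,_ m≡m′ (trans (n-via m n) (trans (cong₂ _+_ D≡ m≡m′) (sym (n-via m′ n′))))
      where
      n-via : ∀ m n → n ≡ n - m + m
      n-via = solve-∀ ℤSolver.ring
      0≤x : ∀ {x} → x ≤ i → 0ℤ ≤ i - x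
      0≤x = ℤ.i≤j⇒0≤j-i
      x<N : ∀ {x} → i < x + (A + B) → i - x < A + B
      x<N {x} i< = subst (i - x <_) (cancel x (A + B)) (ℤ.+-monoˡ-< (- x) i<)
        where
        cancel : ∀ x N → x + N - x ≡ N
        cancel = solve-∀ ℤSolver.ring
      difference : i - L z ≡ i - L z′ + (m′ - m) * (A + B)
      difference = trans (cong (λ n → i - L (m , n)) (trans (n-via m n) (trans (cong (_+ m) D≡) (reorder m m′ n′))))
                         (lemma i ℓ A B m m′ n′)
        where
        reorder : ∀ m m′ n′ → n′ - m′ + m ≡ n′ + (m - m′)
        reorder = solve-∀ ℤSolver.ring
        lemma : ∀ i ℓ A B m m′ n′ → i - (ℓ + (m * A + (n′ + (m - m′)) * B)) ≡
                                    i - (ℓ + (m′ * A + n′ * B)) + (m′ - m) * (A + B)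
        lemma = solve-∀ ℤSolver.ring
      m≡m′ : m ≡ m′
      m≡m′ = sym (ℤ.i-j≡0⇒i≡j m′ m (quotient-unique {A + B} (m′ - m) (0≤x p) (x<N q) (0≤x p′) (x<N q′) difference))

    module _ {S : Index → Set} (follow : Follows ℓ A B S) where

      -- Both directions are kept, so that advancing from diagonal to diagonal also accounts for
      -- going back.
      Linked : Index → Index → Set
      Linked z z′ = (S z → S z′) × (S z′ → S z)

      follow-back : ∀ z j s → i^ (3F ⊕ s) ≡ ~ j → PassesSide ℓ A B (z ⊞ j) s → S (z ⊞ j) → S z
      follow-back z j s eq p q = subst S (trans (cong (z ⊞ j ⊞_) eq) (lemma z j)) (follow s (z ⊞ j) p q)
        where
        lemma : ∀ z j → z ⊞ j ⊞ ~ j ≡ z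
        lemma = solve-∀ gaussianRing

      -- The level of the corner `δ 3F` decides: if it is at most i the strand crosses the side 2F
      -- to the unit above, otherwise the side 3F to the unit on the left.
      advance : ∀ z → Band z → ∃[ z′ ] Band z′ × diagonal z′ ≡ 1ℤ + diagonal z × Linked z z′
      advance z@(m , n) (p , q) with L z + B ≤? i
      ... | yes B≤ = z ⊞ i^ 1F , (subst (_≤ i) (sym L′≡) B≤ , subst (i <_) top′ (ℤ.<-≤-trans q raise))
                   , diag m n
                   , follow 2F z (passes z 2F (inj₂ (B≤ , q)))
                   , follow-back z (i^ 1F) 0F refl (passes (z ⊞ i^ 1F) 0F (inj₁
                       ( subst (_≤ i) (trans (sym L′≡) (sym (ℤ.+-identityʳ (L (z ⊞ i^ 1F))))) B≤
                       , subst (i <_) (trans (assoc (L z) A B) (cong (_+ A) (sym L′≡))) q)))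
        where
        L′≡ : L (z ⊞ i^ 1F) ≡ L z + B
        L′≡ = L-side z 3F
        assoc : ∀ x A B → x + (A + B) ≡ x + B + A
        assoc = solve-∀ ℤSolver.ring
        top′ : L z + B + (A + B) ≡ L (z ⊞ i^ 1F) + (A + B)
        top′ = cong (_+ (A + B)) (sym L′≡)
        raise : L z + (A + B) ≤ L z + B + (A + B)
        raise = ℤ.+-monoˡ-≤ (A + B) (subst (_≤ L z + B) (ℤ.+-identityʳ (L z)) (ℤ.+-monoʳ-≤ (L z) (ℤ.<⇒≤ 0<B)))
        diag : ∀ m n → n + 1ℤ - (m + 0ℤ) ≡ 1ℤ + (n - m)
        diag = solve-∀ ℤSolver.ring
      ... | no B≰ = z ⊞ i^ 2F , (ℤ.≤-trans lower p , subst (i <_) top′ i<)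
                  , diag m n
                  , follow 3F z (passes z 3F (inj₂ (subst (_≤ i) (sym (ℤ.+-identityʳ (L z))) p , i<)))
                  , follow-back z (i^ 2F) 1F refl (passes (z ⊞ i^ 2F) 1F (inj₁
                      (subst (_≤ i) L≡ p , subst (i <_) top′ i<)))
        where
        i< : i < L z + B
        i< = ℤ.≰⇒> B≰
        L≡ : L z ≡ L (z ⊞ i^ 2F) + A
        L≡ = lemma ℓ A B m n
          where
          lemma : ∀ ℓ A B m n → ℓ + (m * A + n * B) ≡ ℓ + ((m + -1ℤ) * A + (n + 0ℤ) * B) + A
          lemma = solve-∀ ℤSolver.ring
        top′ : L z + B ≡ L (z ⊞ i^ 2F) + (A + B)
        top′ = trans (cong (_+ B) L≡) (ℤ.+-assoc (L (z ⊞ i^ 2F)) A B)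
        lower : L (z ⊞ i^ 2F) ≤ L z
        lower = subst₂ _≤_ (ℤ.+-identityʳ (L (z ⊞ i^ 2F))) (sym L≡) (ℤ.+-monoʳ-≤ (L (z ⊞ i^ 2F)) (ℤ.<⇒≤ 0<A))
        diag : ∀ m n → n + 0ℤ - (m + -1ℤ) ≡ 1ℤ + (n - m)
        diag = solve-∀ ℤSolver.ring

      advanceBy : ∀ k z → Band z → ∃[ z′ ] Band z′ × diagonal z′ ≡ + k + diagonal z × Linked z z′
      advanceBy ℕ.zero z b = z , b , sym (ℤ.+-identityˡ (diagonal z)) , (λ x → x) , (λ x → x)
      advanceBy (suc k) z b with advanceBy k z b
      ... | z′ , b′ , D≡ , to , from with advance z′ b′
      ... | z″ , b″ , D′≡ , to′ , from′ =
        z″ , b″ , trans D′≡ (trans (cong (λ x → 1ℤ + x) D≡) (sym (ℤ.+-assoc 1ℤ (+ k) (diagonal z))))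
           , (λ x → to′ (to x)) , (λ x → from (from′ x))

      link-≤ : ∀ z z′ → Band z → Band z′ → diagonal z ≤ diagonal z′ → Linked z z′
      link-≤ z z′ b b′ D≤ with advanceBy ∣ diagonal z′ - diagonal z ∣ z b
      ... | z″ , b″ , D≡ , linked = subst (Linked z) (band-unique z″ z′ b″ b′ (trans D≡
        (trans (cong (_+ diagonal z) (ℤ.0≤i⇒+∣i∣≡i (ℤ.i≤j⇒0≤j-i D≤))) (lemma (diagonal z′) (diagonal z))))) linked
        where
        lemma : ∀ x y → x - y + y ≡ x
        lemma = solve-∀ ℤSolver.ring

      follow-to : ∀ z z′ → Band z → Band z′ → S z → S z′
      follow-to z z′ b b′ with ℤ.≤-total (diagonal z) (diagonal z′)
      ... | inj₁ D≤ = proj₁ (link-≤ z z′ b b′ D≤)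
      ... | inj₂ D≥ = proj₂ (link-≤ z′ z b′ b D≥)

  -- All ℓ are treated at once because a quarter-turn of the tiling changes ℓ.
  FollowTo : ℤ → ℤ → Set₁
  FollowTo A B = ∀ ℓ {S} z z′ → Follows ℓ A B S → Passes ℓ A B z → Passes ℓ A B z′ → S z → S z′

  followTo-rising : ∀ {A B} → 0ℤ < A → 0ℤ < B → FollowTo A B
  followTo-rising 0<A 0<B ℓ z z′ follow p p′ = follow-to follow z z′ (passes⇒band z p) (passes⇒band z′ p′)
    where open Rising {ℓ} 0<A 0<B

  followTo-rotate : ∀ {A B} → FollowTo B (- A) → FollowTo A B
  followTo-rotate {A} {B} walk ℓ {S} z z′ follow p p′ q = subst S (sym (unrotate z′))
    (walk (ℓ + A) (i^ 3F · z) (i^ 3F · z′) (Follows-rotate {ℓ} {A} {B} {S} follow) (Passes-rotate ℓ A B z p) (Passes-rotate ℓ A B z′ p′) (subst S (unrotate z) q))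

  -- A quarter-turn of the tiling replaces (A, B) by (B, - A); at most three of them make both
  -- numbers positive.
  followTo : ∀ {A B} → A ≢ 0ℤ → B ≢ 0ℤ → FollowTo A B
  followTo {A} {B} A≢0 B≢0 with ℤ.<-cmp A 0ℤ | ℤ.<-cmp B 0ℤ
  ... | tri≈ _ A≡0 _ | _            = ⊥-elim (A≢0 A≡0)
  ... | _            | tri≈ _ B≡0 _ = ⊥-elim (B≢0 B≡0)
  ... | tri> _ _ 0<A | tri> _ _ 0<B = followTo-rising 0<A 0<B
  ... | tri< A<0 _ _ | tri> _ _ 0<B = followTo-rotate (followTo-rising 0<B (ℤ.neg-mono-< A<0))
  ... | tri< A<0 _ _ | tri< B<0 _ _ =
    followTo-rotate (followTo-rotate (followTo-rising (ℤ.neg-mono-< A<0) (ℤ.neg-mono-< B<0)))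
  ... | tri> _ _ 0<A | tri< B<0 _ _ =
    followTo-rotate (followTo-rotate (followTo-rotate (followTo-rising (ℤ.neg-mono-< B<0)
      (subst (0ℤ <_) (sym (ℤ.neg-involutive A)) 0<A))))

-- The strands are equivalent under the group

bézout : ∀ a b → Coprime a b → ∃[ x ] ∃[ y ] x * a + y * b ≡ 1ℤ
bézout a b coprime with ±∣i∣ a | ±∣i∣ b | bézoutℕ (coprime-Bézout coprime)
  where
  ±∣i∣ : ∀ i → ∃[ s ] + ∣ i ∣ ≡ s * i
  ±∣i∣ (+ n)    = 1ℤ , sym (ℤ.*-identityˡ (+ n))
  ±∣i∣ -[1+ n ] = -1ℤ , sym (ℤ.-1*i≡-i -[1+ n ])
  cast : ∀ m y n x → 1 ℕ.+ m ℕ.* y ≡ n ℕ.* x → 1ℤ + + m * + y ≡ + n * + x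
  cast m y n x eq = trans (cong (λ w → 1ℤ + w) (sym (ℤ.pos-* m y))) (trans (cong +_ eq) (ℤ.pos-* n x))
  bézoutℕ : ∀ {m n} → Bézout.Identity 1 m n → ∃[ x ] ∃[ y ] x * + m + y * + n ≡ 1ℤ
  bézoutℕ {m} {n} (Bézout.+- x y eq) = + x , - + y ,
    trans (cong (_+ - + y * + n) (sym (cast y n x m eq))) (lemma (+ y) (+ n))
    where
    lemma : ∀ y n → 1ℤ + y * n + - y * n ≡ 1ℤ
    lemma = solve-∀ ℤSolver.ring
  bézoutℕ {m} {n} (Bézout.-+ x y eq) = - + x , + y ,
    trans (cong (λ w → - + x * + m + w) (sym (cast x m y n eq))) (lemma (+ x) (+ m))
    where
    lemma : ∀ x m → - x * m + (1ℤ + x * m) ≡ 1ℤ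
    lemma = solve-∀ ℤSolver.ring
... | s , ∣a∣≡ | t , ∣b∣≡ | x , y , eq = x * s , y * t , (begin
  x * s * a + y * t * b            ≡⟨ cong₂ _+_ (ℤ.*-assoc x s a) (ℤ.*-assoc y t b) ⟩
  x * (s * a) + y * (t * b)        ≡⟨ cong₂ (λ α β → x * α + y * β) ∣a∣≡ ∣b∣≡ ⟨
  x * + ∣ a ∣ + y * + ∣ b ∣        ≡⟨ eq ⟩
  1ℤ                               ∎)

-- The multiples of a - b and a + b include 2a and 2b, hence 2, and an odd
-- number.
bézout-± : ∀ a b → Coprime a b → Odd (a - b) → ∃[ m ] ∃[ n ] m * (a - b) - n * (a + b) ≡ 1ℤ
bézout-± a b coprime (k , a-b≡) with bézout a b coprime
-- Twice x a + y b is (x - y)(a - b) + (x + y)(a + b). Taking k times this from a - b = 1 + 2k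
-- leaves 1.
... | x , y , eq = 1ℤ - k * (x - y) , k * (x + y) , (begin
  (1ℤ - k * (x - y)) * (a - b) - k * (x + y) * (a + b)   ≡⟨ lemma a b k x y ⟩
  a - b - + 2 * k * (x * a + y * b)                      ≡⟨ cong₂ (λ p q → p - + 2 * k * q) a-b≡ eq ⟩
  1ℤ + + 2 * k - + 2 * k * 1ℤ                            ≡⟨ lemma₂ k ⟩
  1ℤ                                                     ∎)
  where
  lemma : ∀ a b k x y → (1ℤ - k * (x - y)) * (a - b) - k * (x + y) * (a + b) ≡
                        a - b - + 2 * k * (x * a + y * b)
  lemma = solve-∀ ℤSolver.ring
  lemma₂ : ∀ k → 1ℤ + + 2 * k - + 2 * k * 1ℤ ≡ 1ℤ
  lemma₂ = solve-∀ ℤSolver.ring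

-- The four strands alongside a corner, to its right, above, to its left and below: the turned
-- images of the warp to the right of a corner.
strandAt : Fin 4 → Point → Strand
strandAt 0F (x , y) = warp x
strandAt 1F (x , y) = weft y
strandAt 2F (x , y) = warp (x - 1ℤ)
strandAt 3F (x , y) = weft (y - 1ℤ)

motion-warp : ∀ k P Q → actStrand (motion k P Q) (warp (proj₁ P)) ≡ strandAt k Q
motion-warp k (px , py) (qx , qy) = go k
  where
  translate : ∀ q p → q - p + p ≡ q
  translate = solve-∀ ℤSolver.ring
  reflect : ∀ q p → q + p - 1ℤ - p ≡ q - 1ℤ
  reflect = solve-∀ ℤSolver.ring
  go : ∀ k → actStrand (motion k (px , py) (qx , qy)) (warp px) ≡ strandAt k (qx , qy)
  go 0F = cong warp (translate qx px)
  go 1F = cong weft (translate qy px)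
  go 2F = cong warp (reflect qx px)
  go 3F = cong weft (reflect qy px)

module Reach (o : Point) (a b : ℤ) (coprime : Coprime a b) (odd : Odd (a - b)) where
  open Lattice o a b

  γ-warp : ∀ k z → actStrand (γ k z) (warp (proj₁ o)) ≡ strandAt k (C z)
  γ-warp k z = trans (cong (λ g → actStrand g (warp (proj₁ o))) (sym (motion≡mot k o (C z))))
                     (motion-warp k o (C z))

  private
    m n : ℤ
    m = proj₁ (bézout-± a b coprime odd)
    n = proj₁ (proj₂ (bézout-± a b coprime odd))

    scale : ∀ t → t * (m * (a - b) - n * (a + b)) ≡ t
    scale t = trans (cong (t *_) (proj₂ (proj₂ (bézout-± a b coprime odd)))) (ℤ.*-identityʳ t)

    -- By the choice of m and n, the product of m + ni with `u` has real part 2. In `corner-y` a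
    -- further factor i makes that the imaginary part.
    corner-x : ∀ t → proj₁ (C (t * m , t * n)) ≡ proj₁ o + + 2 * t
    corner-x t = trans (lemma (proj₁ o) t m n a b) (cong (λ s → proj₁ o + + 2 * s) (scale t))
      where
      lemma : ∀ x t m n a b → x + (t * m * (+ 2 * (a - b)) - t * n * (+ 2 * (a + b))) ≡
                              x + + 2 * (t * (m * (a - b) - n * (a + b)))
      lemma = solve-∀ ℤSolver.ring

    corner-y : ∀ t → proj₂ (C (- (t * n) , t * m)) ≡ proj₂ o + + 2 * t
    corner-y t = trans (lemma (proj₂ o) t m n a b) (cong (λ s → proj₂ o + + 2 * s) (scale t))
      where
      lemma : ∀ y t m n a b → y + (- (t * n) * (+ 2 * (a + b)) + t * m * (+ 2 * (a - b))) ≡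
                              y + + 2 * (t * (m * (a - b) - n * (a + b)))
      lemma = solve-∀ ℤSolver.ring

    even-position : ∀ i x t → i - x ≡ + 2 * t → x + + 2 * t ≡ i
    even-position i x t eq = trans (cong (λ w → x + w) (sym eq)) (lemma x i)
      where
      lemma : ∀ x i → x + (i - x) ≡ i
      lemma = solve-∀ ℤSolver.ring

    odd-position : ∀ i x t → i - x ≡ 1ℤ + + 2 * t → x + + 2 * (t + 1ℤ) - 1ℤ ≡ i
    odd-position i x t eq = trans (lemma x t) (trans (cong (λ w → x + w) (sym eq)) (lemma₂ x i))
      where
      lemma : ∀ x t → x + + 2 * (t + 1ℤ) - 1ℤ ≡ x + (1ℤ + + 2 * t)
      lemma = solve-∀ ℤSolver.ring
      lemma₂ : ∀ x i → x + (i - x) ≡ i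
      lemma₂ = solve-∀ ℤSolver.ring

  reach : ∀ r → ∃[ k ] ∃[ z ] actStrand (γ k z) (warp (proj₁ o)) ≡ r
  reach (warp i) with halve (i - proj₁ o)
  ... | t , inj₁ eq = 0F , (t * m , t * n) ,
    trans (γ-warp 0F (t * m , t * n)) (cong warp (trans (corner-x t) (even-position i (proj₁ o) t eq)))
  -- A warp at an odd distance 1 + 2t lies to the left of a corner at distance 2(t + 1), and a
  -- half-turn brings the warp there.
  ... | t , inj₂ eq = 2F , ((t + 1ℤ) * m , (t + 1ℤ) * n) ,
    trans (γ-warp 2F ((t + 1ℤ) * m , (t + 1ℤ) * n))
          (cong warp (trans (cong (_- 1ℤ) (corner-x (t + 1ℤ))) (odd-position i (proj₁ o) t eq)))
  reach (weft j) with halve (j - proj₂ o)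
  ... | t , inj₁ eq = 1F , (- (t * n) , t * m) ,
    trans (γ-warp 1F (- (t * n) , t * m)) (cong weft (trans (corner-y t) (even-position j (proj₂ o) t eq)))
  ... | t , inj₂ eq = 3F , (- ((t + 1ℤ) * n) , (t + 1ℤ) * m) ,
    trans (γ-warp 3F (- ((t + 1ℤ) * n) , (t + 1ℤ) * m))
          (cong weft (trans (cong (_- 1ℤ) (corner-y (t + 1ℤ))) (odd-position j (proj₂ o) t eq)))

  strands-transitive : ∀ r r′ → ∃[ k ] ∃[ z ] actStrand (γ k z) r ≡ r′
  strands-transitive r r′ with reach r | reach r′
  ... | k , y , refl | l , z , refl =
    l ⊕ ⊖ k , z ⊞ i^ l · ~ (i^ (⊖ k) · y) , (begin
      actStrand (γ (l ⊕ ⊖ k) (z ⊞ i^ l · ~ (i^ (⊖ k) · y))) (actStrand (γ k y) w)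
        ≡⟨ cong (λ g → actStrand g (actStrand (γ k y) w)) (γ-∘ l z (⊖ k) (~ (i^ (⊖ k) · y))) ⟨
      actStrand (γ l z ∘₂ γ (⊖ k) (~ (i^ (⊖ k) · y))) (actStrand (γ k y) w)
        ≡⟨ actStrand-∘ (γ l z) (γ (⊖ k) (~ (i^ (⊖ k) · y))) (actStrand (γ k y) w) ⟩
      actStrand (γ l z) (actStrand (γ (⊖ k) (~ (i^ (⊖ k) · y))) (actStrand (γ k y) w))
        ≡⟨ cong (actStrand (γ l z)) (γ-cancelˡ k y w) ⟩
      actStrand (γ l z) w ∎)
    where
    w = warp (proj₁ o)

-- Doubling, norm and determinant of integer vectors

double-injective : ∀ {P Q} → P ⊞ P ≡ Q ⊞ Q → P ≡ Q
double-injective {P} {Q} eq = cong₂ _,_ (halved (cong proj₁ eq)) (halved (cong proj₂ eq))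
  where
  twice : ∀ x → x + x ≡ + 2 * x
  twice = solve-∀ ℤSolver.ring
  halved : ∀ {x y} → x + x ≡ y + y → x ≡ y
  halved {x} {y} eq = ℤ.*-cancelˡ-≡ (+ 2) x y (trans (sym (twice x)) (trans eq (twice y)))

2⊡ : ∀ P → + 2 ⊡ P ≡ P ⊞ P
2⊡ (x , y) = cong₂ _,_ (twice x) (twice y)
  where
  twice : ∀ x → + 2 * x ≡ x + x
  twice = solve-∀ ℤSolver.ring

norm : Point → ℤ
norm (x , y) = x * x + y * y

i²>0 : ∀ i → i ≢ 0ℤ → 0ℤ < i * i
i²>0 +0       i≢0 = ⊥-elim (i≢0 refl)
i²>0 (+ suc n) _  = +<+ (s≤s z≤n)
i²>0 -[1+ n ]  _  = +<+ (s≤s z≤n)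

0≤i² : ∀ i → 0ℤ ≤ i * i
0≤i² +0        = +≤+ z≤n
0≤i² (+ suc n) = +≤+ z≤n
0≤i² -[1+ n ]  = +≤+ z≤n

-- Multiplication by u scales oriented areas by the norm. When that is positive, the side of a line
-- on which a point lies can be told in index coordinates.
det-· : ∀ x y u → det (x · u) (y · u) ≡ norm u * det x y
det-· (x , x′) (y , y′) (u , u′) = lemma x x′ y y′ u u′
  where
  lemma : ∀ x x′ y y′ u u′ →
    (x * u - x′ * u′) * (y * u′ + y′ * u) - (x * u′ + x′ * u) * (y * u - y′ * u′) ≡
    (u * u + u′ * u′) * (x * y′ - x′ * y)
  lemma = solve-∀ ℤSolver.ring

0≤i≤2 : ∀ {i} → 0ℤ ≤ i → i ≤ + 2 → i ≡ 0ℤ ⊎ i ≡ 1ℤ ⊎ i ≡ + 2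
0≤i≤2 {+ 0} _ _ = inj₁ refl
0≤i≤2 {+ 1} _ _ = inj₂ (inj₁ refl)
0≤i≤2 {+ 2} _ _ = inj₂ (inj₂ refl)
0≤i≤2 {+ suc (suc (suc _))} _ (+≤+ (s≤s (s≤s ())))

-- Sides of units and the rotations that match them

module Geometry (o : Point) (a b : ℤ) (odd : Odd (a - b)) where
  open Tiling o a b
  open Lattice o a b

  a-b≢0 : a - b ≢ 0ℤ
  a-b≢0 = odd⇒≢0 odd

  a+b≢0 : a + b ≢ 0ℤ
  a+b≢0 = odd⇒≢0 (odd-sum {a} {b} odd)

  2*≢0 : ∀ {i} → i ≢ 0ℤ → + 2 * i ≢ 0ℤ
  2*≢0 {i} i≢0 eq = i≢0 (ℤ.*-cancelˡ-≡ (+ 2) i 0ℤ eq)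

  norm-u>0 : 0ℤ < norm u
  norm-u>0 = ℤ.+-mono-<-≤ (i²>0 (+ 2 * (a - b)) (2*≢0 a-b≢0)) (0≤i² (+ 2 * (a + b)))

  -- Strands across sides

  Spans : Strand → Index → Fin 4 → Set
  Spans r w s = SpannedBy (C (w ⊞ δ s)) (C (w ⊞ δ (next s))) r

  crosses≡spans : ∀ r w s → CrossesSide r w s ≡ Spans r w s
  crosses≡spans r w s = cong₂ (λ P Q → SpannedBy P Q r) (start≡C w s) (start≡C w (next s))

  crosses⇒spans : ∀ r w s → CrossesSide r w s → Spans r w s
  crosses⇒spans r w s = subst (λ X → X) (crosses≡spans r w s)

  spans⇒crosses : ∀ r w s → Spans r w s → CrossesSide r w s
  spans⇒crosses r w s = subst (λ X → X) (sym (crosses≡spans r w s))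

  next-corner : ∀ w s → w ⊞ δ (next s) ≡ w ⊞ δ s ⊞ i^ s
  next-corner w s = trans (cong (w ⊞_) (δ-next s)) (lemma w (δ s) (i^ s))
    where
    lemma : ∀ x y z → x ⊞ (y ⊞ z) ≡ x ⊞ y ⊞ z
    lemma = solve-∀ gaussianRing

  SpannedBy-motion : ∀ k y z x r → SpannedBy (C y) (C (y ⊞ x)) r →
                     SpannedBy (C z) (C (z ⊞ i^ k · x)) (actStrand (motion k (C y) (C z)) r)
  SpannedBy-motion k y z x r p = subst (λ g → SpannedBy (C z) (C (z ⊞ i^ k · x)) (actStrand g r))
    (sym (motion≡γ k y z))
    (subst₂ (λ P Q → SpannedBy (C P) (C Q) (actStrand (γ k (z ⊟ i^ k · y)) r))
      (lemma z (i^ k) y) (lemma₂ z (i^ k) y x) (SpannedBy-γ {o} {a} {b} k (z ⊟ i^ k · y) y (y ⊞ x) r p))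
    where
    lemma : ∀ z j y → z ⊞ ~ (j · y) ⊞ j · y ≡ z
    lemma = solve-∀ gaussianRing
    lemma₂ : ∀ z j y x → z ⊞ ~ (j · y) ⊞ j · (y ⊞ x) ≡ z ⊞ j · x
    lemma₂ = solve-∀ gaussianRing

  side-cong : ∀ k w s w′ s′ → motion k (start w s) (start w′ s′) ≡ motion k (C (w ⊞ δ s)) (C (w′ ⊞ δ s′))
  side-cong k w s w′ s′ = cong₂ (motion k) (start≡C w s) (start≡C w′ s′)

  carried : Index → Fin 4 → Index → Fin 4 → Isometry
  carried w s w′ s′ = motion (s′ ⊝ s) (start w s) (start w′ s′)

  carried≡ : ∀ w s w′ s′ → carried w s w′ s′ ≡ motion (s′ ⊝ s) (C (w ⊞ δ s)) (C (w′ ⊞ δ s′))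
  carried≡ w s w′ s′ = side-cong (s′ ⊝ s) w s w′ s′

  next-⊝ : ∀ s t → next s ⊝ next t ≡ s ⊝ t
  next-⊝ = from-yes (Fin.all? λ s → Fin.all? λ t → (next s ⊝ next t) Fin.≟ (s ⊝ t))

  -- A rotation that matches one pair of sides of two units matches the following pair too, so any
  -- side may be used to describe how a face is laid on a unit.
  carried-next : ∀ w s w′ s′ → carried w (next s) w′ (next s′) ≡ carried w s w′ s′
  carried-next w s w′ s′ = begin
    carried w (next s) w′ (next s′)
      ≡⟨ carried≡ w (next s) w′ (next s′) ⟩
    motion (next s′ ⊝ next s) (C (w ⊞ δ (next s))) (C (w′ ⊞ δ (next s′)))
      ≡⟨ cong (λ k → motion k (C (w ⊞ δ (next s))) (C (w′ ⊞ δ (next s′)))) (next-⊝ s′ s) ⟩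
    motion k (C (w ⊞ δ (next s))) (C (w′ ⊞ δ (next s′)))
      ≡⟨ motion-cong k (w ⊞ δ (next s)) (w′ ⊞ δ (next s′)) (w ⊞ δ s) (w′ ⊞ δ s′) same ⟩
    motion k (C (w ⊞ δ s)) (C (w′ ⊞ δ s′))
      ≡⟨ carried≡ w s w′ s′ ⟨
    carried w s w′ s′ ∎
    where
    k = s′ ⊝ s
    lemma : ∀ j x y z → x ⊞ j · z ⊞ ~ (j · (y ⊞ z)) ≡ x ⊞ ~ (j · y)
    lemma = solve-∀ gaussianRing
    same : w′ ⊞ δ (next s′) ⊟ i^ k · (w ⊞ δ (next s)) ≡ w′ ⊞ δ s′ ⊟ i^ k · (w ⊞ δ s)
    same = begin
      w′ ⊞ δ (next s′) ⊟ i^ k · (w ⊞ δ (next s))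
        ≡⟨ cong₂ (λ x y → x ⊟ i^ k · y) (next-corner w′ s′) (next-corner w s) ⟩
      w′ ⊞ δ s′ ⊞ i^ s′ ⊟ i^ k · (w ⊞ δ s ⊞ i^ s)
        ≡⟨ cong (λ x → w′ ⊞ δ s′ ⊞ x ⊟ i^ k · (w ⊞ δ s ⊞ i^ s)) (i^-⊝ s′ s) ⟨
      w′ ⊞ δ s′ ⊞ i^ k · i^ s ⊟ i^ k · (w ⊞ δ s ⊞ i^ s)
        ≡⟨ lemma (i^ k) (w′ ⊞ δ s′) (w ⊞ δ s) (i^ s) ⟩
      w′ ⊞ δ s′ ⊟ i^ k · (w ⊞ δ s) ∎

  spans-carried : ∀ r w s w′ s′ → Spans r w s → Spans (actStrand (carried w s w′ s′) r) w′ s′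
  spans-carried r w s w′ s′ p = subst₂ (λ g P → SpannedBy (C (w′ ⊞ δ s′)) (C P) (actStrand g r))
    (sym (carried≡ w s w′ s′))
    (trans (cong (w′ ⊞ δ s′ ⊞_) (i^-⊝ s′ s)) (sym (next-corner w′ s′)))
    (SpannedBy-motion (s′ ⊝ s) (w ⊞ δ s) (w′ ⊞ δ s′) (i^ s) r
      (subst (λ P → SpannedBy (C (w ⊞ δ s)) (C P) r) (next-corner w s) p))

  -- The rotation that carries w to the unit beyond the side s′ of w′,
  -- matching the sides s and s′.
  joined : Index → Fin 4 → Index → Fin 4 → Isometry
  joined w s w′ s′ = motion (opposite s′ ⊝ s) (start w s) (end w′ s′)

  joined≡ : ∀ w s w′ s′ → joined w s w′ s′ ≡
            motion (opposite s′ ⊝ s) (C (w ⊞ δ s)) (C (w′ ⊞ δ s′ ⊞ i^ s′))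
  joined≡ w s w′ s′ = cong₂ (motion (opposite s′ ⊝ s)) (start≡C w s) (end≡C w′ s′)

  spans-joined : ∀ r w s w′ s′ → Spans r w s → Spans (actStrand (joined w s w′ s′) r) w′ s′
  spans-joined r w s w′ s′ p = subst₂ (λ g P → SpannedBy (C (w′ ⊞ δ s′)) P (actStrand g r))
    (sym (joined≡ w s w′ s′)) (cong C (sym (next-corner w′ s′)))
    -- Joining reverses the side: the direction `i^ s` is turned into minus `i^ s′`, so the ends
    -- arrive in the other order.
    (SpannedBy-sym {o} {a} {b} r′ (subst (λ P → SpannedBy (C (y′ ⊞ i^ s′)) (C P) r′)
      (trans (cong (y′ ⊞ i^ s′ ⊞_) (trans (i^-⊝ (opposite s′) s) (i^-opposite s′))) (lemma y′ (i^ s′)))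
      (SpannedBy-motion (opposite s′ ⊝ s) (w ⊞ δ s) (y′ ⊞ i^ s′) (i^ s) r
        (subst (λ P → SpannedBy (C (w ⊞ δ s)) (C P) r) (next-corner w s) p))))
    where
    y′ = w′ ⊞ δ s′
    r′ = actStrand (motion (opposite s′ ⊝ s) (C (w ⊞ δ s)) (C (y′ ⊞ i^ s′))) r
    lemma : ∀ y j → y ⊞ j ⊞ ~ j ≡ y
    lemma = solve-∀ gaussianRing

  beyond : Index → Fin 4 → Index
  beyond w s = w ⊞ i^ (3F ⊕ s)

  beyond-corner : ∀ w s → beyond w s ⊞ δ (opposite s) ≡ w ⊞ δ s ⊞ i^ s
  beyond-corner w s = begin
    w ⊞ i^ (3F ⊕ s) ⊞ δ (opposite s)     ≡⟨ assoc w (i^ (3F ⊕ s)) (δ (opposite s)) ⟩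
    w ⊞ (i^ (3F ⊕ s) ⊞ δ (opposite s))   ≡⟨ cong (w ⊞_) (finite s) ⟩
    w ⊞ (δ s ⊞ i^ s)                     ≡⟨ assoc w (δ s) (i^ s) ⟨
    w ⊞ δ s ⊞ i^ s                       ∎
    where
    assoc : ∀ x y z → x ⊞ y ⊞ z ≡ x ⊞ (y ⊞ z)
    assoc = solve-∀ gaussianRing
    finite : ∀ s → i^ (3F ⊕ s) ⊞ δ (opposite s) ≡ δ s ⊞ i^ s
    finite = from-yes (Fin.all? λ s → i^ (3F ⊕ s) ⊞ δ (opposite s) ≟ᴾ δ s ⊞ i^ s)

  neighbour≡beyond : ∀ w s → neighbour w s ≡ beyond w s
  neighbour≡beyond (m , n) 0F = cong (_, n - 1ℤ) (sym (ℤ.+-identityʳ m))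
  neighbour≡beyond (m , n) 1F = cong (m + 1ℤ ,_) (sym (ℤ.+-identityʳ n))
  neighbour≡beyond (m , n) 2F = cong (_, n + 1ℤ) (sym (ℤ.+-identityʳ m))
  neighbour≡beyond (m , n) 3F = cong (m - 1ℤ ,_) (sym (ℤ.+-identityʳ n))

  -- One step of rolling: laying `w` on `w₁` and then passing the joined edge has the effect of
  -- laying the unit beyond the side σ of `w` on `w′`.
  joined-carried : ∀ w σ w₁ s w′ s′ →
    joined w₁ s w′ s′ ∘₂ carried w σ w₁ s ≡ carried (beyond w σ) (opposite σ) w′ s′
  joined-carried w σ w₁ s w′ s′ = begin
    joined w₁ s w′ s′ ∘₂ carried w σ w₁ s
      ≡⟨ cong₂ _∘₂_ (trans (joined≡ w₁ s w′ s′) (motion≡γ K₁ y (z ⊞ i^ s′)))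
                    (trans (carried≡ w σ w₁ s) (motion≡γ K₂ x y)) ⟩
    γ K₁ (z ⊞ i^ s′ ⊟ i^ K₁ · y) ∘₂ γ K₂ (y ⊟ i^ K₂ · x)
      ≡⟨ γ-∘ K₁ (z ⊞ i^ s′ ⊟ i^ K₁ · y) K₂ (y ⊟ i^ K₂ · x) ⟩
    γ (K₁ ⊕ K₂) (z ⊞ i^ s′ ⊟ i^ K₁ · y ⊞ i^ K₁ · (y ⊟ i^ K₂ · x))
      ≡⟨ cong (γ (K₁ ⊕ K₂)) (lemma z (i^ s′) (i^ K₁) y (i^ K₂) x) ⟩
    γ (K₁ ⊕ K₂) (z ⊞ i^ s′ ⊟ (i^ K₁ · i^ K₂) · x)
      ≡⟨ cong (λ j → γ (K₁ ⊕ K₂) (z ⊞ i^ s′ ⊟ j · x)) (i^-⊕ K₁ K₂) ⟨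
    γ (K₁ ⊕ K₂) (z ⊞ i^ s′ ⊟ i^ (K₁ ⊕ K₂) · x)
      ≡⟨ cong (λ k → γ k (z ⊞ i^ s′ ⊟ i^ k · x)) (angles σ s s′) ⟩
    γ K₃ (z ⊞ i^ s′ ⊟ i^ K₃ · x)
      ≡⟨ cong (λ j → γ K₃ (z ⊞ j ⊟ i^ K₃ · x)) side-image ⟩
    γ K₃ (z ⊞ ~ (i^ K₃ · i^ σ) ⊟ i^ K₃ · x)
      ≡⟨ cong (γ K₃) (lemma₂ z (i^ K₃) (i^ σ) x) ⟩
    γ K₃ (z ⊟ i^ K₃ · (x ⊞ i^ σ))
      ≡⟨ cong (λ x → γ K₃ (z ⊟ i^ K₃ · x)) (beyond-corner w σ) ⟨
    γ K₃ (z ⊟ i^ K₃ · (beyond w σ ⊞ δ (opposite σ)))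
      ≡⟨ trans (carried≡ (beyond w σ) (opposite σ) w′ s′) (motion≡γ K₃ (beyond w σ ⊞ δ (opposite σ)) z) ⟨
    carried (beyond w σ) (opposite σ) w′ s′ ∎
    where
    K₁ = opposite s′ ⊝ s
    K₂ = s ⊝ σ
    K₃ = s′ ⊝ opposite σ
    x = w ⊞ δ σ
    y = w₁ ⊞ δ s
    z = w′ ⊞ δ s′
    angles : ∀ σ s s′ → (opposite s′ ⊝ s) ⊕ (s ⊝ σ) ≡ s′ ⊝ opposite σ
    angles = from-yes (Fin.all? λ σ → Fin.all? λ s → Fin.all? λ s′ →
      ((opposite s′ ⊝ s) ⊕ (s ⊝ σ)) Fin.≟ (s′ ⊝ opposite σ))
    side-image : i^ s′ ≡ ~ (i^ K₃ · i^ σ)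
    side-image = trans (sym (i^-⊝ s′ (opposite σ)))
      (trans (cong (i^ K₃ ·_) (i^-opposite σ)) (neg-out (i^ K₃) (i^ σ)))
      where
      neg-out : ∀ j x → j · ~ x ≡ ~ (j · x)
      neg-out = solve-∀ gaussianRing
    lemma : ∀ z e j y l x → z ⊞ e ⊞ ~ (j · y) ⊞ j · (y ⊞ ~ (l · x)) ≡ z ⊞ e ⊞ ~ (j · l · x)
    lemma = solve-∀ gaussianRing
    lemma₂ : ∀ z j e x → z ⊞ ~ (j · e) ⊞ ~ (j · x) ≡ z ⊞ ~ (j · (x ⊞ e))
    lemma₂ = solve-∀ gaussianRing

  -- The increments of the levels are the real or the imaginary parts of `u` and i times `u`. Being
  -- twice odd numbers they are not 0: no side is parallel to a strand.
  followStrand : ∀ r (S : Index → Set) → (∀ w s → Spans r w s → S w → S (beyond w s)) →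
                 ∀ w w′ → ∃ (Spans r w) → ∃ (Spans r w′) → S w → S w′
  followStrand (warp i) S follow w w′ (s , p) (s′ , p′) =
    followTo i (2*≢0 a-b≢0) (λ eq → 2*≢0 a+b≢0 (ℤ.neg-injective eq)) (proj₁ o) w w′
      (λ s w p → follow w s (subst (λ X → X) (sym (side w s)) p))
      (s , subst (λ X → X) (side w s) p) (s′ , subst (λ X → X) (side w′ s′) p′)
    where
    level≡ : ∀ z → proj₁ (C z) ≡ level i (proj₁ o) (+ 2 * (a - b)) (- (+ 2 * (a + b))) z
    level≡ (m , n) = lemma (proj₁ o) m n (+ 2 * (a - b)) (+ 2 * (a + b))
      where
      lemma : ∀ x m n s t → x + (m * s - n * t) ≡ x + (m * s + n * - t)
      lemma = solve-∀ ℤSolver.ring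
    side : ∀ w s → Spans (warp i) w s ≡ PassesSide i (proj₁ o) (+ 2 * (a - b)) (- (+ 2 * (a + b))) w s
    side w s = cong₂ (λ x y → Between x y i) (level≡ (w ⊞ δ s)) (level≡ (w ⊞ δ (next s)))
  followStrand (weft j) S follow w w′ p p′ =
    followTo j (2*≢0 a+b≢0) (2*≢0 a-b≢0) (proj₂ o) w w′ (λ s w → follow w s) p p′

-- Fixed points of turns

module FixedPoints (o : Point) (a b : ℤ) (odd : Odd (a - b)) where
  open Tiling o a b
  open Lattice o a b
  open Geometry o a b odd

  turn⇒mot : ∀ {k g} → IsTurn k g → ∃[ Q ] g ≡ mot k Q
  turn⇒mot {k} (Q , refl) = Q , trans (motion≡mot k 𝟘 Q) (cong (mot k) (lemma Q (i^ k)))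
    where
    lemma : ∀ Q j → Q ⊞ ~ (j · 𝟘) ≡ Q
    lemma = solve-∀ gaussianRing

  -- The point o + ½μu, in halves.
  half : Index → Point
  half μ = o ⊞ o ⊞ μ · u

  fixes : ∀ k Q P → actPoint (+ 2) (mot k Q) P ≡ P → Q ⊞ Q ≡ P ⊟ i^ k · P
  fixes k Q P eq = trans (lemma (Q ⊞ Q) (i^ k · P)) (cong (_⊟ i^ k · P) (begin
    Q ⊞ Q ⊞ i^ k · P               ≡⟨ cong (_⊞ i^ k · P) (2⊡ Q) ⟨
    + 2 ⊡ Q ⊞ i^ k · P             ≡⟨ actPoint-mot (+ 2) k Q P ⟨
    actPoint (+ 2) (mot k Q) P     ≡⟨ eq ⟩
    P                              ∎))
    where
    lemma : ∀ x y → x ≡ x ⊞ y ⊞ ~ y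
    lemma = solve-∀ gaussianRing

  -- The turn about o + ½μu takes `o` to o + ½(μ - iᵏμ)u, which is a corner as soon as μ - iᵏμ is
  -- even.
  turn-about : ∀ k Q μ l → actPoint (+ 2) (mot k Q) (half μ) ≡ half μ →
               μ ⊟ i^ k · μ ≡ l ⊞ l → mot k Q ≡ γ k l
  turn-about k Q μ l fixed eq = cong (mot k) (double-injective (begin
    Q ⊞ Q                                                ≡⟨ fixes k Q (half μ) fixed ⟩
    half μ ⊟ i^ k · half μ                                     ≡⟨ lemma o μ u (i^ k) ⟩
    o ⊞ o ⊞ (μ ⊟ i^ k · μ) · u ⊟ i^ k · (o ⊞ o)          ≡⟨ cong (λ x → o ⊞ o ⊞ x · u ⊟ i^ k · (o ⊞ o)) eq ⟩
    o ⊞ o ⊞ (l ⊞ l) · u ⊟ i^ k · (o ⊞ o)                 ≡⟨ lemma₂ o l u (i^ k) ⟩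
    (C l ⊟ i^ k · o) ⊞ (C l ⊟ i^ k · o)                  ∎))
    where
    lemma : ∀ o μ u j → o ⊞ o ⊞ μ · u ⊞ ~ (j · (o ⊞ o ⊞ μ · u)) ≡
                        o ⊞ o ⊞ (μ ⊞ ~ (j · μ)) · u ⊞ ~ (j · (o ⊞ o))
    lemma = solve-∀ gaussianRing
    lemma₂ : ∀ o l u j → o ⊞ o ⊞ (l ⊞ l) · u ⊞ ~ (j · (o ⊞ o)) ≡
                         o ⊞ l · u ⊞ ~ (j · o) ⊞ (o ⊞ l · u ⊞ ~ (j · o))
    lemma₂ = solve-∀ gaussianRing

  corner-half : ∀ w s → + 2 ⊡ start w s ≡ half (w ⊞ δ s ⊞ (w ⊞ δ s))
  corner-half w s = trans (2⊡ (start w s)) (trans (cong (λ P → P ⊞ P) (start≡C w s)) (lemma o (w ⊞ δ s) u))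
    where
    lemma : ∀ o y u → o ⊞ y · u ⊞ (o ⊞ y · u) ≡ o ⊞ o ⊞ (y ⊞ y) · u
    lemma = solve-∀ gaussianRing

  centre-half : ∀ w → start w 0F ⊞ start w 2F ≡ half (w ⊞ w ⊞ (1ℤ , 1ℤ))
  centre-half w = trans (cong₂ _⊞_ (start≡C w 0F) (start≡C w 2F)) (lemma o w u (1ℤ , 1ℤ))
    where
    lemma : ∀ o w u d → o ⊞ (w ⊞ 𝟘) · u ⊞ (o ⊞ (w ⊞ d) · u) ≡ o ⊞ o ⊞ (w ⊞ w ⊞ d) · u
    lemma = solve-∀ gaussianRing

  side-half : ∀ w s → start w s ⊞ end w s ≡ half (w ⊞ w ⊞ (δ s ⊞ δ (next s)))
  side-half w s = trans (cong₂ _⊞_ (start≡C w s) (start≡C w (next s))) (lemma o w u (δ s) (δ (next s)))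
    where
    lemma : ∀ o w u d e → o ⊞ (w ⊞ d) · u ⊞ (o ⊞ (w ⊞ e) · u) ≡ o ⊞ o ⊞ (w ⊞ w ⊞ (d ⊞ e)) · u
    lemma = solve-∀ gaussianRing

  turn-about-centre : ∀ k g P w → IsTurn k g → actPoint (+ 2) g P ≡ P →
                      CentreOfTurn k P w → ∃[ l ] g ≡ γ k l
  turn-about-centre k g P w isTurn fixed centre with turn⇒mot {k} isTurn
  ... | Q , refl = go centre
    where
    about : ∀ P μ l → P ≡ half μ → actPoint (+ 2) (mot k Q) P ≡ P → μ ⊟ i^ k · μ ≡ l ⊞ l →
            ∃[ l ] mot k Q ≡ γ k l
    about P μ l refl fixed eq = l , turn-about k Q μ l fixed eq
    go : CentreOfTurn k P w → ∃[ l ] mot k Q ≡ γ k l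
    go (inj₁ refl) = about (start w 0F ⊞ start w 2F) (w ⊞ w ⊞ (1ℤ , 1ℤ)) (w ⊟ i^ k · w ⊞ δ k) (centre-half w) fixed
      (trans (lemma w (i^ k) (1ℤ , 1ℤ)) (trans (cong (λ d → w ⊟ i^ k · w ⊞ (w ⊟ i^ k · w) ⊞ d) (finite k))
        (lemma₂ (w ⊟ i^ k · w) (δ k))))
      where
      finite : ∀ k → (1ℤ , 1ℤ) ⊟ i^ k · (1ℤ , 1ℤ) ≡ δ k ⊞ δ k
      finite = from-yes (Fin.all? λ k → (1ℤ , 1ℤ) ⊟ i^ k · (1ℤ , 1ℤ) ≟ᴾ δ k ⊞ δ k)
      lemma : ∀ w j d → w ⊞ w ⊞ d ⊞ ~ (j · (w ⊞ w ⊞ d)) ≡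
                        w ⊞ ~ (j · w) ⊞ (w ⊞ ~ (j · w)) ⊞ (d ⊞ ~ (j · d))
      lemma = solve-∀ gaussianRing
      lemma₂ : ∀ x d → x ⊞ x ⊞ (d ⊞ d) ≡ x ⊞ d ⊞ (x ⊞ d)
      lemma₂ = solve-∀ gaussianRing
    go (inj₂ (inj₁ (s , refl))) = about (+ 2 ⊡ start w s) (w ⊞ δ s ⊞ (w ⊞ δ s)) (w ⊞ δ s ⊟ i^ k · (w ⊞ δ s)) (corner-half w s) fixed
      (lemma (w ⊞ δ s) (i^ k))
      where
      lemma : ∀ y j → y ⊞ y ⊞ ~ (j · (y ⊞ y)) ≡ y ⊞ ~ (j · y) ⊞ (y ⊞ ~ (j · y))
      lemma = solve-∀ gaussianRing
    go (inj₂ (inj₂ (refl , s , refl))) = about (start w s ⊞ end w s) (w ⊞ w ⊞ (δ s ⊞ δ (next s))) (w ⊞ w ⊞ (δ s ⊞ δ (next s))) (side-half w s) fixed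
      (lemma (w ⊞ w ⊞ (δ s ⊞ δ (next s))))
      where
      lemma : ∀ y → y ⊞ ~ ((-1ℤ , 0ℤ) · y) ≡ y ⊞ y
      lemma = solve-∀ gaussianRing

  -- For k ≠ 0 this is 2 / (1 - iᵏ), a Gaussian integer; the value at `0F` is a placeholder.
  σ : Fin 4 → Point
  σ 0F = 𝟘
  σ 1F = 1ℤ , 1ℤ
  σ 2F = 𝟙
  σ 3F = 1ℤ , -1ℤ

  σ-inverts : ∀ k → k ≢ 0F → σ k · (𝟙 ⊟ i^ k) ≡ 𝟙 ⊞ 𝟙
  σ-inverts 0F k≢0 = contradiction refl k≢0
  σ-inverts 1F _ = refl
  σ-inverts 2F _ = refl
  σ-inverts 3F _ = refl

  -- The map z ↦ l + iᵏz fixes only l / (1 - iᵏ), which is half of `σ k · l`. Everything is doubled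
  -- to stay within ℤ[i].
  fixed-point : ∀ k l P → k ≢ 0F → actPoint (+ 2) (γ k l) P ≡ P → P ≡ half (σ k · l)
  fixed-point k l P k≢0 fixed = double-injective (begin
    P ⊞ P                                                             ≡⟨ lemma P ⟩
    (𝟙 ⊞ 𝟙) · P                                                       ≡⟨ cong (_· P) (σ-inverts k k≢0) ⟨
    σ k · (𝟙 ⊟ i^ k) · P                                              ≡⟨ lemma₂ (σ k) (i^ k) P ⟩
    σ k · (P ⊟ i^ k · P)                                              ≡⟨ cong (σ k ·_) (fixes k (C l ⊟ i^ k · o) P fixed) ⟨
    σ k · (C l ⊟ i^ k · o ⊞ (C l ⊟ i^ k · o))                         ≡⟨ lemma₃ (σ k) (i^ k) o l u ⟩
    σ k · (𝟙 ⊟ i^ k) · (o ⊞ o) ⊞ (σ k · l · u ⊞ σ k · l · u)          ≡⟨ cong (λ x → x · (o ⊞ o) ⊞ (σ k · l · u ⊞ σ k · l · u)) (σ-inverts k k≢0) ⟩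
    (𝟙 ⊞ 𝟙) · (o ⊞ o) ⊞ (σ k · l · u ⊞ σ k · l · u)                   ≡⟨ lemma₄ o (σ k · l · u) ⟩
    half (σ k · l) ⊞ half (σ k · l)                                         ∎)
    where
    lemma : ∀ P → P ⊞ P ≡ (𝟙 ⊞ 𝟙) · P
    lemma = solve-∀ gaussianRing
    lemma₂ : ∀ s j P → s · (𝟙 ⊞ ~ j) · P ≡ s · (P ⊞ ~ (j · P))
    lemma₂ = solve-∀ gaussianRing
    lemma₃ : ∀ s j o l u → s · (o ⊞ l · u ⊞ ~ (j · o) ⊞ (o ⊞ l · u ⊞ ~ (j · o))) ≡
                           s · (𝟙 ⊞ ~ j) · (o ⊞ o) ⊞ (s · l · u ⊞ s · l · u)
    lemma₃ = solve-∀ gaussianRing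
    lemma₄ : ∀ o x → (𝟙 ⊞ 𝟙) · (o ⊞ o) ⊞ (x ⊞ x) ≡ o ⊞ o ⊞ x ⊞ (o ⊞ o ⊞ x)
    lemma₄ = solve-∀ gaussianRing

  leftOf-half : ∀ μ w s → leftOf (+ 2) (half μ) w s ≡ norm u * det (i^ s) (μ ⊟ (w ⊞ δ s ⊞ (w ⊞ δ s)))
  leftOf-half μ w s = trans (cong₂ det side offset′) (det-· (i^ s) (μ ⊟ (y ⊞ y)) u)
    where
    y = w ⊞ δ s
    side : end w s ⊟ start w s ≡ i^ s · u
    side = trans (cong₂ _⊟_ (end≡C w s) (start≡C w s)) (lemma o y (i^ s) u)
      where
      lemma : ∀ o y j u → o ⊞ (y ⊞ j) · u ⊞ ~ (o ⊞ y · u) ≡ j · u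
      lemma = solve-∀ gaussianRing
    offset′ : half μ ⊟ + 2 ⊡ start w s ≡ (μ ⊟ (y ⊞ y)) · u
    offset′ = trans (cong (half μ ⊟_) (corner-half w s)) (lemma o μ (y ⊞ y) u)
      where
      lemma : ∀ o μ x u → o ⊞ o ⊞ μ · u ⊞ ~ (o ⊞ o ⊞ x · u) ≡ (μ ⊞ ~ x) · u
      lemma = solve-∀ gaussianRing

  0≤norm*⇒0≤ : ∀ x → 0ℤ ≤ norm u * x → 0ℤ ≤ x
  0≤norm*⇒0≤ x p = ℤ.*-cancelˡ-≤-pos 0ℤ x (norm u) {{positive norm-u>0}}
    (subst (_≤ norm u * x) (sym (ℤ.*-zeroʳ (norm u))) p)

  closed-unit-bounds : ∀ μ w → InClosedUnit (+ 2) (half μ) w →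
    let ν = μ ⊟ (w ⊞ w) in
    (0ℤ ≤ proj₁ ν × proj₁ ν ≤ + 2) × (0ℤ ≤ proj₂ ν × proj₂ ν ≤ + 2)
  closed-unit-bounds μ@(x , y) w@(m , n) inside =
      (subst (0ℤ ≤_) (left x m y n) (bound 3F) , ℤ.0≤i-j⇒j≤i (subst (0ℤ ≤_) (right x m y n) (bound 1F)))
    , (subst (0ℤ ≤_) (bottom x m y n) (bound 0F) , ℤ.0≤i-j⇒j≤i (subst (0ℤ ≤_) (top x m y n) (bound 2F)))
    where
    bound : ∀ s → 0ℤ ≤ det (i^ s) (μ ⊟ (w ⊞ δ s ⊞ (w ⊞ δ s)))
    bound s = 0≤norm*⇒0≤ _ (subst (0ℤ ≤_) (leftOf-half μ w s) (inside s))
    bottom : ∀ x m y n → 1ℤ * (y - (n + 0ℤ + (n + 0ℤ))) - 0ℤ * (x - (m + 0ℤ + (m + 0ℤ))) ≡ y - (n + n)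
    bottom = solve-∀ ℤSolver.ring
    right : ∀ x m y n → 0ℤ * (y - (n + 0ℤ + (n + 0ℤ))) - 1ℤ * (x - (m + 1ℤ + (m + 1ℤ))) ≡ + 2 - (x - (m + m))
    right = solve-∀ ℤSolver.ring
    top : ∀ x m y n → -1ℤ * (y - (n + 1ℤ + (n + 1ℤ))) - 0ℤ * (x - (m + 1ℤ + (m + 1ℤ))) ≡ + 2 - (y - (n + n))
    top = solve-∀ ℤSolver.ring
    left : ∀ x m y n → 0ℤ * (y - (n + 1ℤ + (n + 1ℤ))) - -1ℤ * (x - (m + 0ℤ + (m + 0ℤ))) ≡ x - (m + m)
    left = solve-∀ ℤSolver.ring

  -- In doubled index coordinates counted from its first corner the closed unit is the square
  -- [0, 2]², and these are its nine integer points.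
  data Position : Point → Set where
    atCentre : Position (1ℤ , 1ℤ)
    atCorner : ∀ s → Position (δ s ⊞ δ s)
    atSide   : ∀ s → Position (δ s ⊞ δ (next s))

  position : ∀ ν → (0ℤ ≤ proj₁ ν × proj₁ ν ≤ + 2) × (0ℤ ≤ proj₂ ν × proj₂ ν ≤ + 2) → Position ν
  position (x , y) ((p , q) , (p′ , q′)) with 0≤i≤2 p q | 0≤i≤2 p′ q′
  ... | inj₁ refl        | inj₁ refl        = atCorner 0F
  ... | inj₁ refl        | inj₂ (inj₁ refl) = atSide 3F
  ... | inj₁ refl        | inj₂ (inj₂ refl) = atCorner 3F
  ... | inj₂ (inj₁ refl) | inj₁ refl        = atSide 0F
  ... | inj₂ (inj₁ refl) | inj₂ (inj₁ refl) = atCentre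
  ... | inj₂ (inj₁ refl) | inj₂ (inj₂ refl) = atSide 2F
  ... | inj₂ (inj₂ refl) | inj₁ refl        = atCorner 1F
  ... | inj₂ (inj₂ refl) | inj₂ (inj₁ refl) = atSide 1F
  ... | inj₂ (inj₂ refl) | inj₂ (inj₂ refl) = atCorner 2F

  total : Point → ℤ
  total (x , y) = x + y

  σ-even : ∀ k l → k ≢ 0F → k ≢ 2F → ∃[ j ] total (σ k · l) ≡ + 2 * j
  σ-even 0F _ k≢0 _ = contradiction refl k≢0
  σ-even 1F (x , y) _ _ = x , lemma x y
    where
    lemma : ∀ x y → 1ℤ * x - 1ℤ * y + (1ℤ * y + 1ℤ * x) ≡ + 2 * x
    lemma = solve-∀ ℤSolver.ring
  σ-even 2F _ _ k≢2 = contradiction refl k≢2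
  σ-even 3F (x , y) _ _ = y , lemma x y
    where
    lemma : ∀ x y → 1ℤ * x - -1ℤ * y + (1ℤ * y + -1ℤ * x) ≡ + 2 * y
    lemma = solve-∀ ℤSolver.ring

  side-odd : ∀ w s → ∃[ j ] total (w ⊞ w ⊞ (δ s ⊞ δ (next s))) ≡ 1ℤ + + 2 * j
  side-odd (m , n) s with finite s
    where
    finite : ∀ s → ∃[ j ] total (δ s ⊞ δ (next s)) ≡ 1ℤ + + 2 * j
    finite 0F = 0ℤ , refl
    finite 1F = 1ℤ , refl
    finite 2F = 1ℤ , refl
    finite 3F = 0ℤ , refl
  ... | j , eq = m + n + j , trans (lemma m n (proj₁ d) (proj₂ d))
                                   (trans (cong (λ x → + 2 * (m + n) + x) eq) (lemma₂ (m + n) j))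
    where
    d = δ s ⊞ δ (next s)
    lemma : ∀ m n x y → m + m + x + (n + n + y) ≡ + 2 * (m + n) + (x + y)
    lemma = solve-∀ ℤSolver.ring
    lemma₂ : ∀ x j → + 2 * x + (1ℤ + + 2 * j) ≡ 1ℤ + + 2 * (x + j)
    lemma₂ = solve-∀ ℤSolver.ring

  -- Modulo 2, the sum of the coordinates of (1 ± i)l is even, that of the
  -- middle of a side odd.
  side⇒half-turn : ∀ k l w s → k ≢ 0F → σ k · l ≡ w ⊞ w ⊞ (δ s ⊞ δ (next s)) → k ≡ 2F
  side⇒half-turn k l w s k≢0 eq = decidable-stable (k Fin.≟ 2F) λ k≢2 →
    let i , even = σ-even k l k≢0 k≢2
        j , odd′ = side-odd w s
    in even≢odd {i} {j} (trans (sym even) (trans (cong total eq) odd′))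

  centre-of-turn : ∀ k l P w → k ≢ 0F → actPoint (+ 2) (γ k l) P ≡ P →
                   InClosedUnit (+ 2) P w → CentreOfTurn k P w
  centre-of-turn k l P w k≢0 fixed inside =
    go (μ ⊟ (w ⊞ w)) refl (position (μ ⊟ (w ⊞ w)) (closed-unit-bounds μ w (subst (λ P → InClosedUnit (+ 2) P w) P≡ inside)))
    where
    μ = σ k · l
    P≡ : P ≡ half μ
    P≡ = fixed-point k l P k≢0 fixed
    recentre : ∀ ν → μ ⊟ (w ⊞ w) ≡ ν → μ ≡ w ⊞ w ⊞ ν
    recentre ν eq = trans (lemma μ (w ⊞ w)) (cong (w ⊞ w ⊞_) eq)
      where
      lemma : ∀ μ x → μ ≡ x ⊞ (μ ⊞ ~ x)
      lemma = solve-∀ gaussianRing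
    corner-shift : ∀ d → w ⊞ w ⊞ (d ⊞ d) ≡ w ⊞ d ⊞ (w ⊞ d)
    corner-shift d = lemma w d
      where
      lemma : ∀ w d → w ⊞ w ⊞ (d ⊞ d) ≡ w ⊞ d ⊞ (w ⊞ d)
      lemma = solve-∀ gaussianRing
    go : ∀ ν → μ ⊟ (w ⊞ w) ≡ ν → Position ν → CentreOfTurn k P w
    go ν eq atCentre      = inj₁ (trans P≡ (trans (cong half (recentre ν eq)) (sym (centre-half w))))
    go ν eq (atCorner s) = inj₂ (inj₁ (s , trans P≡
      (trans (cong half (trans (recentre ν eq) (corner-shift (δ s)))) (sym (corner-half w s)))))
    go ν eq (atSide s)    = inj₂ (inj₂ (side⇒half-turn k l w s k≢0 (recentre ν eq)
      , s , trans P≡ (trans (cong half (recentre ν eq)) (sym (side-half w s)))))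

-- Preserving and exchanging the two colours

data Change : Set where
  keep exchange : Change

change : Change → Colour → Colour
change keep     = λ x → x
change exchange = flip

change-flip : ∀ c x → change c (flip x) ≡ flip (change c x)
change-flip keep     x = refl
change-flip exchange x = refl

between : ∀ x y → ∃[ c ] y ≡ change c x
between dark dark = keep , refl
between dark pale = exchange , refl
between pale dark = exchange , refl
between pale pale = keep , refl

flip-≢ : ∀ x → x ≢ flip x
flip-≢ dark ()
flip-≢ pale ()

-- `flip` fixes no colour, so the image of one strand tells which alternative of perfect colouring
-- holds.
change-unique : ∀ c c′ x → change c x ≡ change c′ x → c ≡ c′
change-unique keep     keep     x eq = refl
change-unique keep     exchange x eq = contradiction eq (flip-≢ x)
change-unique exchange keep     x eq = contradiction (sym eq) (flip-≢ x)
change-unique exchange exchange x eq = refl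

odd-neg : ∀ {i} → Odd i → Odd (- i)
odd-neg {i} (j , refl) = - j - 1ℤ , lemma j
  where
  lemma : ∀ j → - (1ℤ + + 2 * j) ≡ 1ℤ + + 2 * (- j - 1ℤ)
  lemma = solve-∀ ℤSolver.ring

-- The cube woven from a given net

module Cube
  {F : Prefabric} {c d : Point} {a b : ℤ} (species : Species33₄ F c d a b)
  {p q : ℤ} (perfect : Perfect F (thickStriping p q))
  {o : Point} (o-centre : o ≡ c ⊎ o ≡ d)
  (redundant : ∀ w → RedundantCentre (thickStriping p q) (Tiling.corner o a b w))
  (N : Net o a b) where

  open Species33₄ species
  κ : Colouring
  κ = thickStriping p q

  open Tiling o a b
  open Net N
  open WovenCube F κ o a b N

  odd : Odd (a - b)
  odd = oppositeParity⇒odd {a} {b} oppositeParity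

  open Lattice o a b
  open Geometry o a b odd
  open FixedPoints o a b odd
  open Reach o a b coprime odd
  open SymmetryGroup (symmetryGroup species o-centre)

  -- Colours of corners

  colour : Index → Colour
  colour z = κ (warp (proj₁ (C z)))

  -- The four strands alongside a corner are those of its block, and the block is redundant.
  colour-strandAt : ∀ k z → κ (strandAt k (C z)) ≡ colour z
  colour-strandAt k z = go k (subst (RedundantCentre κ) (corner≡C z) (redundant z))
    where
    go : ∀ k → RedundantCentre κ (C z) → κ (strandAt k (C z)) ≡ colour z
    go 0F _                 = refl
    go 1F (_ , _ , eq)      = sym eq
    go 2F (eq , _ , _)      = eq
    go 3F (_ , eq , eq′)    = trans eq (sym eq′)

  colour-step : ∀ z s → colour (z ⊞ i^ s) ≡ flip (colour z)
  colour-step z@(m , n) s = trans (cong (stripe p) (x-step s)) (stripe-shift p (proj₁ (C z)) (odd-step s))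
    where
    -- Half the real part of `i^ s · u`.
    step : Fin 4 → ℤ
    step 0F = a - b
    step 1F = - (a + b)
    step 2F = - (a - b)
    step 3F = - - (a + b)
    odd-step : ∀ s → Odd (step s)
    odd-step 0F = odd
    odd-step 1F = odd-neg (odd-sum {a} {b} odd)
    odd-step 2F = odd-neg odd
    odd-step 3F = odd-neg (odd-neg (odd-sum {a} {b} odd))
    step₀ : ∀ x m n a b → x + ((m + 1ℤ) * (+ 2 * (a - b)) - (n + 0ℤ) * (+ 2 * (a + b))) ≡
                          x + (m * (+ 2 * (a - b)) - n * (+ 2 * (a + b))) + + 2 * (a - b)
    step₀ = solve-∀ ℤSolver.ring
    step₁ : ∀ x m n a b → x + ((m + 0ℤ) * (+ 2 * (a - b)) - (n + 1ℤ) * (+ 2 * (a + b))) ≡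
                          x + (m * (+ 2 * (a - b)) - n * (+ 2 * (a + b))) + + 2 * - (a + b)
    step₁ = solve-∀ ℤSolver.ring
    step₂ : ∀ x m n a b → x + ((m + -1ℤ) * (+ 2 * (a - b)) - (n + 0ℤ) * (+ 2 * (a + b))) ≡
                          x + (m * (+ 2 * (a - b)) - n * (+ 2 * (a + b))) + + 2 * - (a - b)
    step₂ = solve-∀ ℤSolver.ring
    step₃ : ∀ x m n a b → x + ((m + 0ℤ) * (+ 2 * (a - b)) - (n + -1ℤ) * (+ 2 * (a + b))) ≡
                          x + (m * (+ 2 * (a - b)) - n * (+ 2 * (a + b))) + + 2 * - - (a + b)
    step₃ = solve-∀ ℤSolver.ring
    x-step : ∀ s → proj₁ (C (z ⊞ i^ s)) ≡ proj₁ (C z) + + 2 * step s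
    x-step 0F = step₀ (proj₁ o) m n a b
    x-step 1F = step₁ (proj₁ o) m n a b
    x-step 2F = step₂ (proj₁ o) m n a b
    x-step 3F = step₃ (proj₁ o) m n a b

  motion-symmetry : ∀ k y z → IsSymmetry F (motion k (C y) (C z) , e)
  motion-symmetry k y z = subst (λ g → IsSymmetry F (g , e)) (sym (motion≡γ k y z))
                                (γ-symmetry k (z ⊟ i^ k · y))

  -- The rotation takes a strand alongside the corner y to one alongside z, and what happens to the
  -- colour of that strand happens to all.
  motion-colour : ∀ k y z ch → colour z ≡ change ch (colour y) →
                  ∀ r → κ (actStrand (motion k (C y) (C z)) r) ≡ change ch (κ r)
  motion-colour k y z ch eq = perfect-change
    (perfect (motion k (C y) (C z)) e (motion-symmetry k y z))
    where
    g = motion k (C y) (C z)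
    image : κ (actStrand g (warp (proj₁ (C y)))) ≡ change ch (colour y)
    image = trans (cong κ (motion-warp k (C y) (C z))) (trans (colour-strandAt k z) eq)
    conclude : ∀ ch′ → (∀ r → κ (actStrand g r) ≡ change ch′ (κ r)) →
               ∀ r → κ (actStrand g r) ≡ change ch (κ r)
    conclude ch′ p = subst (λ ch → ∀ r → κ (actStrand g r) ≡ change ch (κ r))
      (change-unique ch′ ch (colour y) (trans (sym (p (warp (proj₁ (C y))))) image)) p
    perfect-change : (∀ r → κ (actStrand g r) ≡ κ r) ⊎ (∀ r → κ (actStrand g r) ≡ flip (κ r)) →
                     ∀ r → κ (actStrand g r) ≡ change ch (κ r)
    perfect-change (inj₁ p) = conclude keep p
    perfect-change (inj₂ p) = conclude exchange p

  -- Colours of the vertices of the cube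

  flagColour : Face → Face → Colour
  flagColour f t = colour (place f ⊞ δ (side f t))

  flagColour-turn : ∀ {f t} → f ⟂ t → flagColour f (turn f t) ≡ flip (flagColour f t)
  flagColour-turn {f} {t} f⟂t = begin
    colour (place f ⊞ δ (side f (turn f t)))    ≡⟨ cong (λ s → colour (place f ⊞ δ s)) (ccw f t f⟂t) ⟩
    colour (place f ⊞ δ (next (side f t)))      ≡⟨ cong colour (next-corner (place f) (side f t)) ⟩
    colour (place f ⊞ δ (side f t) ⊞ i^ (side f t))  ≡⟨ colour-step (place f ⊞ δ (side f t)) (side f t) ⟩
    flip (flagColour f t)                       ∎

  flagColour-hinge : ∀ {f t} → Hinge f t → flagColour t f ≡ flip (flagColour f t)
  flagColour-hinge {f} {t} (_ , place≡ , side≡) = begin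
    colour (place t ⊞ δ (side t f))
      ≡⟨ cong₂ (λ w s → colour (w ⊞ δ s)) (trans place≡ (neighbour≡beyond (place f) (side f t))) side≡ ⟩
    colour (beyond (place f) (side f t) ⊞ δ (opposite (side f t)))
      ≡⟨ cong colour (beyond-corner (place f) (side f t)) ⟩
    colour (place f ⊞ δ (side f t) ⊞ i^ (side f t))
      ≡⟨ colour-step (place f ⊞ δ (side f t)) (side f t) ⟩
    flip (flagColour f t) ∎

  private
    +x⟂+y : +x ⟂ +y
    +x⟂+y = from-yes (+x ⟂? +y)

    base : ∃[ ch ] flagColour +x +y ≡ change ch (vertexColour +x +y)
    base = between (vertexColour +x +y) (flagColour +x +y)

    ch₀ = proj₁ base

    Agrees : Face → Face → Set
    Agrees f t = flagColour f t ≡ change ch₀ (vertexColour f t)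

    agrees-flip : ∀ {x x′ y y′} → x′ ≡ flip x → y′ ≡ flip y → x ≡ change ch₀ y → x′ ≡ change ch₀ y′
    agrees-flip {x} {x′} {y} {y′} x′≡ y′≡ eq = begin
      x′                       ≡⟨ x′≡ ⟩
      flip x                   ≡⟨ cong flip eq ⟩
      flip (change ch₀ y)      ≡⟨ change-flip ch₀ y ⟨
      change ch₀ (flip y)      ≡⟨ cong (change ch₀) y′≡ ⟨
      change ch₀ y′            ∎

    agrees-turn : ∀ {f t} → f ⟂ t → Agrees f t → Agrees f (turn f t)
    agrees-turn {f} {t} f⟂t = agrees-flip (flagColour-turn f⟂t) (vertexColour-turn f t f⟂t)

    agrees-face : ∀ {f t t′} → f ⟂ t → f ⟂ t′ → Agrees f t → Agrees f t′
    agrees-face = face-induction Agrees agrees-turn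

    -- At a hinge two faces share a side in the plane, so agreement passes from one to the other;
    -- turning then spreads it round the new face.
    agrees-hinges : ∀ {f f′} → Star Hinge f f′ → (∀ t → f ⟂ t → Agrees f t) → ∀ t → f′ ⟂ t → Agrees f′ t
    agrees-hinges ε agree = agree
    agrees-hinges {f} (_◅_ {j = g} h@(f⟂g , _) hs) agree = agrees-hinges hs λ t g⟂t →
      agrees-face (⟂-sym f g f⟂g) g⟂t
        (agrees-flip (flagColour-hinge h) (vertexColour-sym f g f⟂g) (agree g f⟂g))

    agrees : ∀ f t → f ⟂ t → Agrees f t
    agrees f = agrees-hinges (connected +x f) (λ t +x⟂t → agrees-face +x⟂+y +x⟂t (proj₂ base))

  -- Across a cut edge this cannot be seen in the plane. It holds for the vertices of the cube, with
  -- which the corners agree up to the one change `ch₀`.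
  flagColour-sym : ∀ {f t} → f ⟂ t → flagColour t f ≡ flip (flagColour f t)
  flagColour-sym {f} {t} f⟂t = begin
    flagColour t f                              ≡⟨ agrees t f (⟂-sym f t f⟂t) ⟩
    change ch₀ (vertexColour t f)               ≡⟨ cong (change ch₀) (vertexColour-sym f t f⟂t) ⟩
    change ch₀ (flip (vertexColour f t))        ≡⟨ change-flip ch₀ (vertexColour f t) ⟩
    flip (change ch₀ (vertexColour f t))        ≡⟨ cong flip (agrees f t f⟂t) ⟨
    flip (flagColour f t)                       ∎

  -- The woven cube

  carried-symmetry : ∀ w s w′ s′ → IsSymmetry F (carried w s w′ s′ , e)
  carried-symmetry w s w′ s′ = subst (λ g → IsSymmetry F (g , e)) (sym (carried≡ w s w′ s′))
    (motion-symmetry (s′ ⊝ s) (w ⊞ δ s) (w′ ⊞ δ s′))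

  joined-symmetry : ∀ w s w′ s′ → IsSymmetry F (joined w s w′ s′ , e)
  joined-symmetry w s w′ s′ = subst (λ g → IsSymmetry F (g , e)) (sym (joined≡ w s w′ s′))
    (motion-symmetry (opposite s′ ⊝ s) (w ⊞ δ s) (w′ ⊞ δ s′ ⊞ i^ s′))

  join-colour : ∀ f t → f ⟂ t → ∀ r → κ (actStrand (join f t) r) ≡ κ r
  join-colour f t f⟂t r = trans (cong (λ g → κ (actStrand g r)) (joined≡ w s w′ s′))
    (motion-colour (opposite s′ ⊝ s) (w ⊞ δ s) (w′ ⊞ δ s′ ⊞ i^ s′) keep
      -- The start of one side goes to the end of the other: one flip for passing along the side,
      -- one for reversing the flag.
      (trans (colour-step (w′ ⊞ δ s′) s′) (trans (cong flip (flagColour-sym f⟂t)) (flip-involutive (flagColour f t)))) r)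
    where
    w = place f
    s = side f t
    w′ = place t
    s′ = side t f

  isWovenCube : IsWovenCube
  isWovenCube = record
    { strands = λ f t _ r p → spans⇒crosses (actStrand (join f t) r) (place t) (side t f)
        (spans-joined r (place f) (side f t) (place t) (side t f) (crosses⇒spans r (place f) (side f t) p))
    ; weaving = λ f t _ k _ → joined-symmetry (place f) (side f t) (place t) (side t f) k
    ; colours = λ f t f⟂t r _ → join-colour f t f⟂t r
    }

  -- Transitivity

  -- A way of laying the face f of the cube on the unit w, with obverse side
  -- out.
  Laid : Index → Face → Isometry → Fin 4 → Set
  Laid w f h s = ∃[ t ] f ⟂ t × h ≡ carried w s (place f) (side f t)

  laid-next : ∀ {w f h} s → Laid w f h s → Laid w f h (next s)
  laid-next {w} {f} {h} s (t , f⟂t , h≡) = turn f t , ⟂-turn f t f⟂t , (begin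
    h                                                        ≡⟨ h≡ ⟩
    carried w s (place f) (side f t)                         ≡⟨ carried-next w s (place f) (side f t) ⟨
    carried w (next s) (place f) (next (side f t))           ≡⟨ cong (carried w (next s) (place f)) (ccw f t f⟂t) ⟨
    carried w (next s) (place f) (side f (turn f t))         ∎)

  laid-all : ∀ {w f h} s → Laid w f h s → ∀ s′ → Laid w f h s′
  laid-all {w} {f} {h} s p s′ = subst (Laid w f h) (difference s s′) (go (s′ ⊝ s))
    where
    difference : ∀ s s′ → (s′ ⊝ s) ⊕ s ≡ s′
    difference = from-yes (Fin.all? λ s → Fin.all? λ s′ → ((s′ ⊝ s) ⊕ s) Fin.≟ s′)
    go : ∀ k → Laid w f h (k ⊕ s)
    go 0F = p
    go 1F = laid-next s p
    go 2F = laid-next (next s) (laid-next s p)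
    go 3F = laid-next (next (next s)) (laid-next (next s) (laid-next s p))

  -- The cube can be rolled along the strand r, from a face through which the
  -- strand of the cube of the piece x passes, so that it comes to lie on w.
  Rolled : Piece → Strand → Index → Set
  Rolled x r w = ∃[ f ] ∃[ h ] (∀ s → Laid w f h s) × SameStrand (f , actStrand h r) x

  -- The face t across the edge met by the strand comes to lie on the unit beyond s. The strand of
  -- the cube remains the same, since the new piece continues the old one.
  roll : ∀ x r w s → Spans r w s → Rolled x r w → Rolled x r (beyond w s)
  roll x r w s p (f , h , laid , same) with laid s
  ... | t , f⟂t , h≡ = t , join f t ∘₂ h , laid-all (opposite s) (f , ⟂-sym f t f⟂t , h′≡)
                     , subst (λ r′ → SameStrand (t , r′) x) (sym (actStrand-∘ (join f t) h r)) (bwd continues ◅ same)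
    where
    h′≡ : join f t ∘₂ h ≡ carried (beyond w s) (opposite s) (place t) (side t f)
    h′≡ = trans (cong (join f t ∘₂_) h≡) (joined-carried w s (place f) (side f t) (place t) (side t f))
    continues : Continues (f , actStrand h r) (t , actStrand (join f t) (actStrand h r))
    continues = across f⟂t (spans⇒crosses (actStrand h r) (place f) (side f t)
      (subst (λ g → Spans (actStrand g r) (place f) (side f t)) (sym h≡)
        (spans-carried r w s (place f) (side f t) p)))

  -- A symmetry of the plane takes r′ to r and the unit of f′ to a unit w₀ on r. The cube is laid on
  -- w₀ with the face f′ and rolled along r to the unit of f. The face that then lies there, being
  -- the image of f, determines R.
  strand-transitive : ∀ f r f′ r′ → CrossesUnit r (place f) → CrossesUnit r′ (place f′) →
    ∃[ R ] ∃[ t ] f ⟂ t × SameStrand (to R f , actStrand (move R f t) r) (f′ , r′)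
  strand-transitive f r f′ r′ (s , crosses) (s′ , crosses′) = result (strands-transitive r′ r)
    where
    w′ = place f′
    result : ∃[ k ] ∃[ z ] actStrand (γ k z) r′ ≡ r →
             ∃[ R ] ∃[ t ] f ⟂ t × SameStrand (to R f , actStrand (move R f t) r) (f′ , r′)
    result (k , z , γr′≡r) = finish (followStrand r (Rolled (f′ , r′) r) (roll (f′ , r′) r)
        w₀ (place f) (k ⊕ s′ , spans₀) (s , crosses⇒spans r (place f) s crosses) rolled₀)
      where
      w₀ : Index
      -- The turn takes the first corner of w′ to the corner number k of the image, whence the
      -- correction by `δ k`.
      w₀ = z ⊞ i^ k · w′ ⊟ δ k

      corner₀ : ∀ s → z ⊞ i^ k · (w′ ⊞ δ s) ≡ w₀ ⊞ δ (k ⊕ s)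
      corner₀ s = trans (lemma z (i^ k) w′ (δ s) (δ k)) (cong (w₀ ⊞_) (sym (δ-⊕ k s)))
        where
        lemma : ∀ z j w d e → z ⊞ j · (w ⊞ d) ≡ z ⊞ j · w ⊞ ~ e ⊞ (e ⊞ j · d)
        lemma = solve-∀ gaussianRing

      spans₀ : Spans r w₀ (k ⊕ s′)
      spans₀ = subst₂ (λ s″ r → SpannedBy (C (w₀ ⊞ δ (k ⊕ s′))) (C (w₀ ⊞ δ s″)) r) (⊕-next k s′) γr′≡r
        (subst₂ (λ P Q → SpannedBy (C P) (C Q) (actStrand (γ k z) r′)) (corner₀ s′) (corner₀ (next s′))
          (SpannedBy-γ {o} {a} {b} k z (w′ ⊞ δ s′) (w′ ⊞ δ (next s′)) r′ (crosses⇒spans r′ w′ s′ crosses′)))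
        where
        ⊕-next : ∀ k s → k ⊕ next s ≡ next (k ⊕ s)
        ⊕-next = from-yes (Fin.all? λ k → Fin.all? λ s → (k ⊕ next s) Fin.≟ next (k ⊕ s))

      h₀ : Isometry
      h₀ = γ (⊖ k) (~ (i^ (⊖ k) · z))

      h₀≡ : ∀ s → h₀ ≡ carried w₀ (k ⊕ s) w′ s
      h₀≡ s = begin
        γ (⊖ k) (~ (i^ (⊖ k) · z))
          ≡⟨ cong (γ (⊖ k)) (lemma (i^ (⊖ k)) z (w′ ⊞ δ s)) ⟩
        γ (⊖ k) (𝟙 · (w′ ⊞ δ s) ⊟ (i^ (⊖ k) · z ⊞ 𝟙 · (w′ ⊞ δ s)))
          ≡⟨ cong (λ j → γ (⊖ k) (𝟙 · (w′ ⊞ δ s) ⊟ (i^ (⊖ k) · z ⊞ j · (w′ ⊞ δ s)))) (i^-⊖ k) ⟨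
        γ (⊖ k) (𝟙 · (w′ ⊞ δ s) ⊟ (i^ (⊖ k) · z ⊞ i^ (⊖ k) · i^ k · (w′ ⊞ δ s)))
          ≡⟨ cong (γ (⊖ k)) (lemma₂ (i^ (⊖ k)) (i^ k) z (w′ ⊞ δ s)) ⟩
        γ (⊖ k) (w′ ⊞ δ s ⊟ i^ (⊖ k) · (z ⊞ i^ k · (w′ ⊞ δ s)))
          ≡⟨ cong (λ x → γ (⊖ k) (w′ ⊞ δ s ⊟ i^ (⊖ k) · x)) (corner₀ s) ⟩
        γ (⊖ k) (w′ ⊞ δ s ⊟ i^ (⊖ k) · (w₀ ⊞ δ (k ⊕ s)))
          ≡⟨ cong (λ l → γ l (w′ ⊞ δ s ⊟ i^ l · (w₀ ⊞ δ (k ⊕ s)))) (angle k s) ⟩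
        γ (s ⊝ (k ⊕ s)) (w′ ⊞ δ s ⊟ i^ (s ⊝ (k ⊕ s)) · (w₀ ⊞ δ (k ⊕ s)))
          ≡⟨ motion≡γ (s ⊝ (k ⊕ s)) (w₀ ⊞ δ (k ⊕ s)) (w′ ⊞ δ s) ⟨
        motion (s ⊝ (k ⊕ s)) (C (w₀ ⊞ δ (k ⊕ s))) (C (w′ ⊞ δ s))
          ≡⟨ carried≡ w₀ (k ⊕ s) w′ s ⟨
        carried w₀ (k ⊕ s) w′ s ∎
        where
        angle : ∀ k s → ⊖ k ≡ s ⊝ (k ⊕ s)
        angle = from-yes (Fin.all? λ k → Fin.all? λ s → (⊖ k) Fin.≟ (s ⊝ (k ⊕ s)))
        lemma : ∀ j z x → ~ (j · z) ≡ 𝟙 · x ⊞ ~ (j · z ⊞ 𝟙 · x)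
        lemma = solve-∀ gaussianRing
        lemma₂ : ∀ j l z x → 𝟙 · x ⊞ ~ (j · z ⊞ j · l · x) ≡ x ⊞ ~ (j · (z ⊞ l · x))
        lemma₂ = solve-∀ gaussianRing

      rolled₀ : Rolled (f′ , r′) r w₀
      rolled₀ = f′ , h₀ , laid-all (k ⊕ side f′ t) (t , f′⟂t , h₀≡ (side f′ t))
              , subst (λ r″ → SameStrand (f′ , r″) (f′ , r′)) (sym h₀r≡r′) ε
        where
        t = proj₁ (neighbourOf f′)
        f′⟂t = proj₂ (neighbourOf f′)
        h₀r≡r′ : actStrand h₀ r ≡ r′
        h₀r≡r′ = trans (cong (actStrand h₀) (sym γr′≡r)) (γ-cancelˡ k z r′)

      finish : Rolled (f′ , r′) r (place f) →
               ∃[ R ] ∃[ t ] f ⟂ t × SameStrand (to R f , actStrand (move R f t) r) (f′ , r′)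
      finish (f₁ , h , laid , same) =
        R , t , f⟂t , subst (λ x → SameStrand x (f′ , r′)) (cong₂ _,_ (sym Rf≡f₁) h-move) same
        where
        t = proj₁ (neighbourOf f)
        f⟂t = proj₂ (neighbourOf f)
        t₁ = proj₁ (laid (side f t))
        -- The edge lying on the side of f towards t completes a flag, and the rotation taking (f,
        -- t) to it acts on f exactly as h does.
        rotated = rotation f⟂t (proj₁ (proj₂ (laid (side f t))))
        R = proj₁ rotated
        Rf≡f₁ : to R f ≡ f₁
        Rf≡f₁ = proj₁ (proj₂ rotated)
        Rt≡t₁ : to R t ≡ t₁
        Rt≡t₁ = proj₂ (proj₂ rotated)
        h-move : actStrand h r ≡ actStrand (move R f t) r
        h-move = cong (λ g → actStrand g r) (trans (proj₂ (proj₂ (laid (side f t))))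
          (cong₂ (λ g t′ → carried (place f) (side f t) (place g) (side g t′)) (sym Rf≡f₁) (sym Rt≡t₁)))

  isIsonemal : IsIsonemal
  isIsonemal = record
    { facesAlike = λ f f′ → 0F , 0F , λ k _ → carried-symmetry (place f) 0F (place f′) 0F k
    ; rotations  = λ R f t _ k _ →
        carried-symmetry (place f) (side f t) (place (to R f)) (side (to R f) (to R t)) k
    ; transitive = strand-transitive
    ; centres    = λ k g P f _ isTurn fixed centre →
        let l , g≡ = turn-about-centre k g P (place f) isTurn fixed centre
        in subst (λ g → IsSymmetry F (g , e)) (sym g≡) (γ-symmetry k l)
    ; noOthers   = noOthers
    }
    where
    noOthers : ∀ k g η P f → k ≢ 0F → IsTurn k g → actPoint (+ 2) g P ≡ P →
               InClosedUnit (+ 2) P (place f) → IsSymmetry F (g , η) → CentreOfTurn k P (place f)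
    noOthers k g η P f k≢0 isTurn fixed inside symmetry =
      centre-of-turn k l P (place f) k≢0 (subst (λ g → actPoint (+ 2) g P ≡ P) g≡γ fixed) inside
      where
      group-element : ∃[ k ] ∃[ z ] g ≡ γ k z
      group-element = symmetry-γ symmetry
      k′ = proj₁ group-element
      l = proj₁ (proj₂ group-element)
      as-mot : ∃[ Q ] g ≡ mot k Q
      as-mot = turn⇒mot {k} isTurn
      -- The group supplies an angle of its own; both angles are read off the same isometry.
      k≡k′ : k ≡ k′
      k≡k′ = proj₁ (mot-injective (trans (sym (proj₂ as-mot)) (proj₂ (proj₂ group-element))))
      g≡γ : g ≡ γ k l
      g≡γ = subst (λ k → g ≡ γ k l) (sym k≡k′) (proj₂ (proj₂ group-element))

  isPerfectlyColoured : PerfectlyColoured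
  isPerfectlyColoured R = conclude (between (flagColour +x +y) (flagColour (to R +x) (to R +y)))
    where
    module _ (ch : Change) (start≡ : flagColour (to R +x) (to R +y) ≡ change ch (flagColour +x +y)) where
      Changes : Face → Face → Set
      Changes f t = flagColour (to R f) (to R t) ≡ change ch (flagColour f t)

      both-flip : ∀ {x x′ y y′} → x′ ≡ flip x → y′ ≡ flip y → x ≡ change ch y → x′ ≡ change ch y′
      both-flip {y = y} refl refl refl = sym (change-flip ch y)

      changes : ∀ f t → f ⟂ t → Changes f t
      -- The colours at a flag and at its image both flip when the flag is turned or reversed, so
      -- their relation at one flag persists at all.
      changes f t f⟂t = flag-induction Changes
        (λ {f} {t} f⟂t → both-flip
          (trans (cong (flagColour (to R f)) (to-turn R f t)) (flagColour-turn (to-⟂ R f⟂t)))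
          (flagColour-turn f⟂t))
        (λ {f} {t} f⟂t → both-flip (flagColour-sym (to-⟂ R f⟂t)) (flagColour-sym f⟂t))
        +x⟂+y f⟂t start≡

      shown-change : ∀ f t → f ⟂ t → ∀ k → shown (actCell (move R f t) k) ≡ change ch (shown k)
      shown-change f t f⟂t k = begin
        κ (over F (actCell (move R f t) k))
          ≡⟨ cong κ (carried-symmetry w s w′ s′ k) ⟨
        κ (actStrand (move R f t) (over F k))
          ≡⟨ cong (λ g → κ (actStrand g (over F k))) (carried≡ w s w′ s′) ⟩
        κ (actStrand (motion (s′ ⊝ s) (C (w ⊞ δ s)) (C (w′ ⊞ δ s′))) (over F k))
          ≡⟨ motion-colour (s′ ⊝ s) (w ⊞ δ s) (w′ ⊞ δ s′) ch (changes f t f⟂t) (over F k) ⟩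
        change ch (κ (over F k)) ∎
        where
        w = place f
        s = side f t
        w′ = place (to R f)
        s′ = side (to R f) (to R t)

    conclude : ∃[ ch ] flagColour (to R +x) (to R +y) ≡ change ch (flagColour +x +y) → _
    conclude (keep , eq)     = inj₁ λ f t f⟂t k _ → shown-change keep eq f t f⟂t k
    conclude (exchange , eq) = inj₂ λ f t f⟂t k _ → shown-change exchange eq f t f⟂t k

theorem6p2 : (F : Prefabric) → IsFabric F →
    (c d : Point) (a b : ℤ) → Species33₄ F c d a b →
    (p q : ℤ) → Perfect F (thickStriping p q) →
    (o : Point) → (o ≡ c) ⊎ (o ≡ d) →
    ((w : Index) → RedundantCentre (thickStriping p q) (Tiling.corner o a b w)) →
    (N : Net o a b) →
    WovenCube.IsPerfectlyColouredIsonemalWovenCube F (thickStriping p q) o a b N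
theorem6p2 F _ c d a b species p q perfect o o-centre redundant N = record
  { wovenCube         = isWovenCube
  ; isonemal          = isIsonemal
  ; perfectlyColoured = isPerfectlyColoured
  }
  where open Cube species perfect o-centre redundant N
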